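{- For a nonnegative integer $n$, let $b_3(n)$ denote the number of $3$-regular partitions of $n$. Then, as a coefficientwise congruence of power series in $\mathbb{Z}[[q]]$, $$\sum_{n=0}^{\infty}b_{3}(34n+24)q^n\equiv \sum_{n=0}^{\infty}b_{3}(2n)q^{17n}\pmod 2,$$ and therefore, for all integers $n\ge 0$, $$b_3(2\cdot 17^2n+58)\equiv 0\pmod 2,$$ and, for all integers $k\geq 1$ and $n\ge 0$, $$b_3\left(2\cdot 17^{2k}n+17^{2k-2}\cdot 58+24\left(\frac{17^{2k-2}-1}{288}\right)\right)\equiv 0\pmod 2.$$
   Context: For a positive integer $\ell$, an $\ell$-regular partition of $n$ is a partition of $n$ none of whose parts is divisible by $\ell$; $b_\ell(n)$ denotes the number of $\ell$-regular partitions of $n$, with $b_\ell(0)=1$. Equivalently, $\sum_{n=0}^{\infty}b_{\ell}(n)q^n=\prod_{j=1}^{\infty}\frac{1-q^{\ell j}}{1-q^{j}}$. A congruence modulo $2$ between power series means congruence of all corresponding coefficients. -}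

module Defs where

open import Data.Integer.Base as ℤ using (ℤ)
import Data.Integer.Divisibility as ℤ
open import Data.List.Base using (List; []; _∷_; _++_; map; concatMap; filter; length; replicate; upTo)
open import Data.List.Properties using (∷-injectiveʳ; ++-cancelˡ)
open import Data.List.Membership.Propositional using (_∈_; find)
open import Data.List.Membership.Propositional.Properties
  using (∈-map⁺; ∈-map⁻; ∈-concatMap⁺; ∈-concatMap⁻; ∈-upTo⁺; ∈-upTo⁻; ∈-filter⁺; ∈-filter⁻)
open import Data.List.Relation.Unary.All as All using (All; []; _∷_; all?)
import Data.List.Relation.Unary.All.Properties as All
open import Data.List.Relation.Unary.AllPairs as AllPairs using (AllPairs; []; _∷_)
import Data.List.Relation.Unary.AllPairs.Properties as AllPairs
open import Data.List.Relation.Unary.Any as Any using (here; there)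
open import Data.List.Relation.Unary.Unique.Propositional using (Unique)
import Data.List.Relation.Unary.Unique.Propositional.Properties as Unique
open import Data.List.Relation.Binary.Disjoint.Propositional using (Disjoint)
open import Data.Nat
open import Data.Nat.ListAction using (sum)
open import Data.Nat.ListAction.Properties using (sum-++)
open import Data.Nat.DivMod using (m/n*n≤m; m*n/n≡m; /-monoˡ-≤)
open import Data.Nat.Divisibility
open import Data.Nat.Properties
open import Data.Product using (∃; _×_; _,_; proj₁; proj₂)
open import Function.Base using (_∘_)
open import Function.Bundles using (_⇔_; mk⇔; module Equivalence)
open import Relation.Binary.PropositionalEquality
open import Relation.Nullary using (¬_; yes; no; ¬?)
open import Relation.Nullary.Negation using (contradiction)
open import Relation.Unary using (Decidable)

------------------------------------------------------------------------
-- Partitions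

-- The parts of a partition are listed in weakly decreasing order, so that
-- distinct lists are distinct partitions.

record IsPartition (n : ℕ) (xs : List ℕ) : Set where
  constructor mkIsPartition
  field
    decreasing : AllPairs _≥_ xs
    positive   : All (0 <_) xs
    total      : sum xs ≡ n

IsRegular : ℕ → List ℕ → Set
IsRegular ℓ = All (λ x → ¬ ℓ ∣ x)

isRegular? : ∀ ℓ → Decidable (IsRegular ℓ)
isRegular? ℓ = all? (λ x → ¬? (ℓ ∣? x))

-- Partitions of n with all parts at most k, by the multiplicity j of the
-- part k.

partitionsUpTo : ℕ → ℕ → List (List ℕ)
partitionsUpTo zero    zero    = [] ∷ []
partitionsUpTo zero    (suc _) = []
partitionsUpTo (suc k) n       =
  concatMap (λ j → map (replicate j (suc k) ++_) (partitionsUpTo k (n ∸ j * suc k)))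
            (upTo (suc (n / suc k)))

partitions : ℕ → List (List ℕ)
partitions n = partitionsUpTo n n

regularPartitions : ℕ → ℕ → List (List ℕ)
regularPartitions ℓ n = filter (isRegular? ℓ) (partitions n)

-- The length of this list is the number of ℓ-regular partitions of n by
-- ∈-regularPartitions and regularPartitions-unique below.

b : ℕ → ℕ → ℕ
b ℓ n = length (regularPartitions ℓ n)

------------------------------------------------------------------------
-- Power series

PowerSeries : Set
PowerSeries = ℕ → ℤ

-- ∑ₙ a(n) qᵈⁿ

dilate : ∀ d .{{_ : NonZero d}} → (ℕ → ℤ) → PowerSeries
dilate d a m with d ∣? m
... | yes d∣m = a (quotient d∣m)
... | no  _   = ℤ.0ℤ

infix 4 _≡_[mod_] _≋_[mod_]

_≡_[mod_] : ℤ → ℤ → ℤ → Set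
x ≡ y [mod m ] = m ℤ.∣ (x ℤ.- y)

_≋_[mod_] : PowerSeries → PowerSeries → ℤ → Set
f ≋ g [mod m ] = ∀ n → f n ≡ g n [mod m ]

------------------------------------------------------------------------
-- Correctness of the enumeration

private

  sum-replicate : ∀ j x → sum (replicate j x) ≡ j * x
  sum-replicate zero    x = refl
  sum-replicate (suc j) x = cong (x +_) (sum-replicate j x)

  sum-prefix : ∀ j x ys → sum (replicate j x ++ ys) ≡ j * x + sum ys
  sum-prefix j x ys =
    trans (sum-++ (replicate j x) ys) (cong (_+ sum ys) (sum-replicate j x))

  IsBounded : ℕ → ℕ → List ℕ → Set
  IsBounded k n xs = IsPartition n xs × All (_≤ k) xs

  unfold⁻ : ∀ k n {xs} → xs ∈ partitionsUpTo (suc k) n →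
            ∃ λ j → ∃ λ ys → j * suc k ≤ n ×
            ys ∈ partitionsUpTo k (n ∸ j * suc k) × xs ≡ replicate j (suc k) ++ ys
  unfold⁻ k n xs∈
    with j , j∈ , p ← find (∈-concatMap⁻ _ {xs = upTo (suc (n / suc k))} xs∈)
    with ys , ys∈ , eq ← ∈-map⁻ _ p =
      j , ys ,
      ≤-trans (*-monoˡ-≤ (suc k) (s≤s⁻¹ (∈-upTo⁻ j∈))) (m/n*n≤m n (suc k)) ,
      ys∈ , eq

  unfold⁺ : ∀ k n j {ys} → j * suc k ≤ n → ys ∈ partitionsUpTo k (n ∸ j * suc k) →
            replicate j (suc k) ++ ys ∈ partitionsUpTo (suc k) n
  unfold⁺ k n j j≤ ys∈ =
    ∈-concatMap⁺ _ (Any.map (λ { refl → ∈-map⁺ _ ys∈ }) (∈-upTo⁺ (s≤s j≤n/k)))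
    where
    j≤n/k : j ≤ n / suc k
    j≤n/k = subst (_≤ n / suc k) (m*n/n≡m j (suc k)) (/-monoˡ-≤ (suc k) j≤)

  prefix-decreasing : ∀ j {k ys} → All (_≤ k) ys → AllPairs _≥_ ys →
                      AllPairs _≥_ (replicate j (suc k) ++ ys)
  prefix-decreasing zero    ys≤ ys↘ = ys↘
  prefix-decreasing (suc j) ys≤ ys↘ =
    All.++⁺ (All.replicate⁺ j ≤-refl) (All.map m≤n⇒m≤1+n ys≤) ∷ prefix-decreasing j ys≤ ys↘

  sound : ∀ k n {xs} → xs ∈ partitionsUpTo k n → IsBounded k n xs
  sound zero    zero    (here refl) = mkIsPartition [] [] refl , []
  sound (suc k) n xs∈
    with j , ys , j≤ , ys∈ , refl ← unfold⁻ k n xs∈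
    with mkIsPartition ys↘ ys>0 Σys , ys≤ ← sound k _ ys∈ =
      mkIsPartition
        (prefix-decreasing j ys≤ ys↘)
        (All.++⁺ (All.replicate⁺ j z<s) ys>0)
        (trans (sum-prefix j (suc k) ys) (trans (cong (j * suc k +_) Σys) (m+[n∸m]≡n j≤))) ,
      All.++⁺ (All.replicate⁺ j ≤-refl) (All.map m≤n⇒m≤1+n ys≤)

  split : ∀ k {xs} → AllPairs _≥_ xs → All (_≤ suc k) xs →
          ∃ λ j → ∃ λ ys → xs ≡ replicate j (suc k) ++ ys × AllPairs _≥_ ys × All (_≤ k) ys
  split k [] [] = 0 , [] , refl , [] , []
  split k {x ∷ xs} (x≥ ∷ xs↘) (x≤ ∷ xs≤) with x ≟ suc k
  ... | yes refl with j , ys , refl , ys↘ , ys≤ ← split k xs↘ xs≤ =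
    suc j , ys , refl , ys↘ , ys≤
  ... | no x≢ = 0 , x ∷ xs , refl , x≥ ∷ xs↘ , x≤k ∷ All.map (λ y≤x → ≤-trans y≤x x≤k) x≥
    where
    x≤k : x ≤ k
    x≤k = s≤s⁻¹ (≤∧≢⇒< x≤ x≢)

  complete : ∀ k n {xs} → IsBounded k n xs → xs ∈ partitionsUpTo k n
  complete zero n {[]}     (mkIsPartition _ _ refl , _) = here refl
  complete zero n {x ∷ xs} (mkIsPartition _ (x>0 ∷ _) _ , x≤0 ∷ _) =
    contradiction x>0 (≤⇒≯ x≤0)
  complete (suc k) n (mkIsPartition xs↘ xs>0 Σxs , xs≤)
    with j , ys , refl , ys↘ , ys≤ ← split k xs↘ xs≤ =
      unfold⁺ k n j
        (subst (j * suc k ≤_) eq (m≤m+n _ _))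
        (complete k _
          ( mkIsPartition ys↘ (All.++⁻ʳ (replicate j (suc k)) xs>0)
              (trans (sym (m+n∸m≡n (j * suc k) (sum ys))) (cong (_∸ j * suc k) eq))
          , ys≤))
    where
    eq : j * suc k + sum ys ≡ n
    eq = trans (sym (sum-prefix j (suc k) ys)) Σxs

  multiplicity-unique : ∀ k i j {ys zs} → All (_≤ k) ys → All (_≤ k) zs →
                        replicate i (suc k) ++ ys ≡ replicate j (suc k) ++ zs → i ≡ j
  multiplicity-unique k zero    zero    _ _ _ = refl
  multiplicity-unique k zero    (suc j) (y≤k ∷ _) _ refl = contradiction y≤k 1+n≰n
  multiplicity-unique k (suc i) zero    _ (z≤k ∷ _) refl = contradiction z≤k 1+n≰n
  multiplicity-unique k (suc i) (suc j) ys≤ zs≤ eq =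
    cong suc (multiplicity-unique k i j ys≤ zs≤ (∷-injectiveʳ eq))

  unique : ∀ k n → Unique (partitionsUpTo k n)
  unique zero    zero    = [] ∷ []
  unique zero    (suc n) = []
  unique (suc k) n =
    Unique.concat⁺
      (All.map⁺ (All.universal
        (λ j → Unique.map⁺ (++-cancelˡ (replicate j (suc k)) _ _) (unique k _)) _))
      (AllPairs.map⁺ (AllPairs.map disjoint (Unique.upTo⁺ (suc (n / suc k)))))
    where
    block : ℕ → List (List ℕ)
    block j = map (replicate j (suc k) ++_) (partitionsUpTo k (n ∸ j * suc k))

    disjoint : ∀ {i j} → i ≢ j → Disjoint (block i) (block j)
    disjoint {i} {j} i≢j (xs∈i , xs∈j)
      with ys , ys∈ , refl ← ∈-map⁻ _ xs∈i
      with zs , zs∈ , eq   ← ∈-map⁻ _ xs∈j =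
        i≢j (multiplicity-unique k i j (proj₂ (sound k _ ys∈)) (proj₂ (sound k _ zs∈)) eq)

  parts≤sum : ∀ xs → All (_≤ sum xs) xs
  parts≤sum []       = []
  parts≤sum (x ∷ xs) =
    m≤m+n x (sum xs) ∷ All.map (λ y≤ → ≤-trans y≤ (m≤n+m (sum xs) x)) (parts≤sum xs)

∈-partitions : ∀ {n xs} → xs ∈ partitions n ⇔ IsPartition n xs
∈-partitions {n} {xs} = mk⇔ (proj₁ ∘ sound n n) λ p →
  complete n n (p , subst (λ m → All (_≤ m) xs) (IsPartition.total p) (parts≤sum xs))

∈-regularPartitions : ∀ {ℓ n xs} →
                      xs ∈ regularPartitions ℓ n ⇔ (IsPartition n xs × IsRegular ℓ xs)
∈-regularPartitions {ℓ} {n} = mk⇔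
  (λ xs∈ → let p , r = ∈-filter⁻ (isRegular? ℓ) {xs = partitions n} xs∈
           in  to p , r)
  (λ (p , r) → ∈-filter⁺ (isRegular? ℓ) (from p) r)
  where open Equivalence (∈-partitions {n}) using (to; from)

regularPartitions-unique : ∀ ℓ n → Unique (regularPartitions ℓ n)
regularPartitions-unique ℓ n = Unique.filter⁺ (isRegular? ℓ) (unique n n)

b-zero : ∀ ℓ → b ℓ 0 ≡ 1
b-zero ℓ = refl

------------------------------------------------------------------------
-- (17²ᵏ⁻² ∸ 1) / 288 is an exact quotient

288∣17^[2k∸2]∸1 : ∀ k → 288 ∣ 17 ^ (2 * k ∸ 2) ∸ 1
288∣17^[2k∸2]∸1 k =
  subst (λ e → 288 ∣ 17 ^ e ∸ 1) (*-distribˡ-∸ 2 k 1)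
    (subst (λ x → 288 ∣ x ∸ 1) (^-*-assoc 17 2 (k ∸ 1)) (go (k ∸ 1)))
  where
  go : ∀ m → 288 ∣ 289 ^ m ∸ 1
  go zero    = divides 0 refl
  go (suc m) = subst (288 ∣_) eq (∣m∣n⇒∣m+n (go m) (m∣m*n (289 ^ m)))
    where
    eq : (289 ^ m ∸ 1) + 288 * 289 ^ m ≡ 289 ^ suc m ∸ 1
    eq = sym (+-∸-comm (288 * 289 ^ m) (m^n>0 289 m))

{-# OPTIONS --safe #-}

-- All generating functions live in 𝔽₂[[q]]. Write φ_d = ∏ⱼ (1 + q^{dj}), and let θ_t be the sum of
-- q^n over those n for which tn + 1 is a square. The Jacobi triple product, with the exponents
-- completed to squares, gives φ₁ = θ₂₄, φ₁³ = θ₈ and φ₃³ = φ₁ θ₃. For B = ∑ b₃(n) qⁿ we have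
-- B φ₁ = φ₃, hence B φ₃² = θ₃, and the even-exponent part of this reads A φ₃ = φ₁⁴ for
-- A = ∑ b₃(2n) qⁿ. The 3-dissection θ₈(q) = θ₂₄(q³) + q θ₈(q⁹) shows that φ₁³ = φ₃ Θ, where Θ is the
-- sum of q^{y²} over y = 0 and the y ≥ 1 prime to 3. Therefore A = θ₂₄ Θ, so that A counts, modulo 2,
-- the representations 24n + 1 = x² + 24y² with x, y ≥ 0 and either y = 0 or 3 ∤ y. Since -24 is not
-- a square modulo 17, 17 ∣ x² + 24y² forces 17 ∣ x and 17 ∣ y, and cancelling 17² relates the
-- coefficients of A at 17n + 12 and n/17.

module Submission where

open import Defs
import Algebra.Bundles
import Algebra.Solver.Ring
open import Algebra.Solver.Ring.AlmostCommutativeRing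
  using (AlmostCommutativeRing; fromCommutativeRing; _-Raw-AlmostCommutative⟶_)
open import Data.Bool.Base using (Bool; true; false; not; _∧_; _xor_)
import Data.Bool.Properties as Bool
open import Data.Bool.Properties
  using (xor-∧-commutativeRing; xor-same; xor-identityʳ; xor-assoc; xor-comm; ∧-comm; ∧-assoc;
         ∧-zeroʳ; ∧-identityʳ; not-injective; not-involutive; not-distribˡ-xor)
open import Data.Integer as ℤ using (+_; _⊖_)
open import Data.Integer.Properties using (m-n≡m⊖n; [1+m]⊖[1+n]≡m⊖n)
open import Data.List.Base
  using (List; []; _∷_; _++_; map; concatMap; filter; length; replicate; upTo; applyUpTo)
open import Data.List.Properties
  using (map-upTo; concatMap-cong; concatMap-map; map-concatMap; map-∘; map-id; ++-identityʳ;
         filter-++; filter-accept; filter-reject; length-++)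
open import Data.List.Relation.Unary.All using (_∷_)
open import Data.Maybe.Base as Maybe using (Maybe)
open import Data.Nat
  using (ℕ; zero; suc; _+_; _*_; _∸_; _^_; _/_; _%_; _≤_; _<_; _≥_; z≤n; s≤s; _≡ᵇ_; _≟_; _≤?_; _<?_;
         NonZero; >-nonZero⁻¹)
open import Data.Nat.Coprimality using (coprime?; coprime-divisor)
open import Data.Nat.Divisibility
open import Data.Nat.DivMod
open import Data.Nat.Primality using (Prime; prime?; euclidsLemma)
open import Data.Nat.Properties
import Data.Nat.Tactic.RingSolver as ℕ-Solver
open import Data.Product using (∃; _×_; _,_; proj₁; proj₂)
open import Data.Sum using (_⊎_; inj₁; inj₂; [_,_]′)
open import Function.Base using (_∘_; id; case_of_)
open import Function.Bundles using (mk⇔)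
open import Level using (0ℓ)
open import Relation.Binary.Bundles using (Setoid)
open import Relation.Binary.Definitions using (tri<; tri≈; tri>)
open import Relation.Binary.PropositionalEquality hiding (J)
open import Relation.Nullary using (¬_; Dec; does; yes; no; contradiction)
open import Relation.Nullary.Decidable
  using (map′; from-yes; _→-dec_; _⊎-dec_; _×-dec_; ¬?; dec-true; dec-false; does-⇔; dec⇒maybe)
open import Relation.Unary using (Decidable)

-- Power series over 𝔽₂

-- Characteristic 2 removes the signs from the triple product and makes squaring the substitution q
-- → q², so φ_d² = φ_{2d}. Infinite products are compared modulo q^{d+1}, where they agree with long
-- finite ones, and division is replaced by cancelling a series with constant term 1. The even part
-- of B φ₃² = θ₃ can be taken because φ₃² = φ₆ is a series in q² and so becomes φ₃; on the other
-- side 6n + 1 is a square only if 4 ∣ n, which leaves θ₂₄(q⁴) = φ₄ = φ₁⁴. The progression comes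
-- from 34n + 24 = 2(17n + 12) and 24(17n + 12) + 1 = 17(24n + 17): every representation counted at
-- 17n + 12 is divisible by 17. The condition 3 ∤ y survives the cancellation because 17 is prime to
-- 3. Since 24·12 + 1 = 17², the two factors of A contribute there only at exponents 12 + 289i′ and
-- 289j′, so the coefficient vanishes unless 17 ∣ n. The last congruence iterates this relation down
-- to an index where 17 ∤ n.

module 𝔽₂ = Algebra.Bundles.CommutativeRing xor-∧-commutativeRing

Series : Set
Series = ℕ → Bool

infix  4 _≈_
infixl 6 _⊕_
infixl 7 _⊛_ _·_

record _≈_ (f g : Series) : Set where
  constructor mk≈
  field at : ∀ n → f n ≡ g n
open _≈_

tail : Series → Series
tail f = f ∘ suc

𝟘 𝟙 : Series
𝟘 _ = false
𝟙 zero    = true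
𝟙 (suc _) = false

_⊕_ _⊛_ : Series → Series → Series
(f ⊕ g) n = f n xor g n
(f ⊛ g) zero    = f 0 ∧ g 0
(f ⊛ g) (suc n) = (f 0 ∧ g (suc n)) xor (tail f ⊛ g) n

_·_ : Bool → Series → Series
(x · f) n = x ∧ f n

≈-setoid : Setoid 0ℓ 0ℓ
≈-setoid = record
  { Carrier = Series ; _≈_ = _≈_
  ; isEquivalence = record
    { refl  = mk≈ λ _ → refl
    ; sym   = λ p → mk≈ λ n → sym (at p n)
    ; trans = λ p q → mk≈ λ n → trans (at p n) (at q n)
    }
  }

open Setoid ≈-setoid using () renaming (refl to ≈-refl; sym to ≈-sym; trans to ≈-trans)
module ≈-Reasoning where
  open import Relation.Binary.Reasoning.Setoid ≈-setoid public

private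
  xor-interchange : ∀ w x y z → (w xor x) xor (y xor z) ≡ (w xor y) xor (x xor z)
  xor-interchange w x y z = begin
    (w xor x) xor (y xor z) ≡⟨ xor-assoc w x _ ⟩
    w xor (x xor (y xor z)) ≡⟨ cong (w xor_) (xor-assoc x y z) ⟨
    w xor ((x xor y) xor z) ≡⟨ cong (λ u → w xor (u xor z)) (xor-comm x y) ⟩
    w xor ((y xor x) xor z) ≡⟨ cong (w xor_) (xor-assoc y x z) ⟩
    w xor (y xor (x xor z)) ≡⟨ xor-assoc w y _ ⟨
    (w xor y) xor (x xor z) ∎
    where open ≡-Reasoning

-- Only pairs with `i + j ≡ n` have to agree. This restriction carries both the truncated congruence
-- `⊛-cong[]` and the comparison of terms in `section₁₇`, where the equality fails for general
-- pairs.
⊛-cong-at : ∀ n {f f′ g g′} → (∀ i j → i + j ≡ n → f i ∧ g j ≡ f′ i ∧ g′ j) →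
            (f ⊛ g) n ≡ (f′ ⊛ g′) n
⊛-cong-at zero    h = h 0 0 refl
⊛-cong-at (suc n) h = cong₂ _xor_ (h 0 (suc n) refl) (⊛-cong-at n λ i j eq → h (suc i) j (cong suc eq))

⊛-cong : ∀ {f f′ g g′} → f ≈ f′ → g ≈ g′ → f ⊛ g ≈ f′ ⊛ g′
⊛-cong p q = mk≈ λ n → ⊛-cong-at n λ i j _ → cong₂ _∧_ (at p i) (at q j)

⊕-cong : ∀ {f f′ g g′} → f ≈ f′ → g ≈ g′ → f ⊕ g ≈ f′ ⊕ g′
⊕-cong p q = mk≈ λ n → cong₂ _xor_ (at p n) (at q n)

⊕-congˡ : ∀ f {g g′} → g ≈ g′ → f ⊕ g ≈ f ⊕ g′
⊕-congˡ f p = mk≈ λ n → cong (f n xor_) (at p n)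

⊕-congʳ : ∀ g {f f′} → f ≈ f′ → f ⊕ g ≈ f′ ⊕ g
⊕-congʳ g p = mk≈ λ n → cong (_xor g n) (at p n)

-- The product recurses on its left factor; this is the mirror recursion on the right factor, from
-- which commutativity and cancellation follow.
⊛-tailʳ : ∀ f g n → (f ⊛ g) (suc n) ≡ (f ⊛ tail g) n xor (f (suc n) ∧ g 0)
⊛-tailʳ f g zero    = refl
⊛-tailʳ f g (suc n) =
  trans (cong ((f 0 ∧ g (suc (suc n))) xor_) (⊛-tailʳ (tail f) g n)) (sym (xor-assoc (f 0 ∧ _) _ _))

⊛-comm-at : ∀ f g n → (f ⊛ g) n ≡ (g ⊛ f) n
⊛-comm-at f g zero    = ∧-comm (f 0) (g 0)
⊛-comm-at f g (suc n) = begin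
  (f 0 ∧ g (suc n)) xor (tail f ⊛ g) n ≡⟨ cong₂ _xor_ (∧-comm (f 0) _) (⊛-comm-at (tail f) g n) ⟩
  (g (suc n) ∧ f 0) xor (g ⊛ tail f) n ≡⟨ xor-comm (g (suc n) ∧ f 0) _ ⟩
  (g ⊛ tail f) n xor (g (suc n) ∧ f 0) ≡⟨ ⊛-tailʳ g f n ⟨
  (g ⊛ f) (suc n)                      ∎
  where open ≡-Reasoning

⊛-distribʳ-at : ∀ h f g n → ((f ⊕ g) ⊛ h) n ≡ (f ⊛ h ⊕ g ⊛ h) n
⊛-distribʳ-at h f g zero    = 𝔽₂.distribʳ (h 0) (f 0) (g 0)
⊛-distribʳ-at h f g (suc n) =
  trans (cong₂ _xor_ (𝔽₂.distribʳ (h (suc n)) (f 0) (g 0)) (⊛-distribʳ-at h (tail f) (tail g) n))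
        (xor-interchange (f 0 ∧ _) _ _ _)

·-⊛-at : ∀ x f g n → ((x · f) ⊛ g) n ≡ x ∧ (f ⊛ g) n
·-⊛-at x f g zero    = ∧-assoc x (f 0) (g 0)
·-⊛-at x f g (suc n) =
  trans (cong₂ _xor_ (∧-assoc x (f 0) _) (·-⊛-at x (tail f) g n)) (sym (𝔽₂.distribˡ x _ _))

⊛-assoc-at : ∀ f g h n → ((f ⊛ g) ⊛ h) n ≡ (f ⊛ (g ⊛ h)) n
⊛-assoc-at f g h zero    = ∧-assoc (f 0) (g 0) (h 0)
⊛-assoc-at f g h (suc n) = begin
  ((f 0 ∧ g 0) ∧ h (suc n)) xor ((f 0 · tail g ⊕ tail f ⊛ g) ⊛ h) n
    ≡⟨ cong₂ _xor_ (∧-assoc (f 0) _ _) (⊛-distribʳ-at h (f 0 · tail g) (tail f ⊛ g) n) ⟩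
  (f 0 ∧ (g 0 ∧ h (suc n))) xor (((f 0 · tail g) ⊛ h) n xor ((tail f ⊛ g) ⊛ h) n)
    ≡⟨ cong₂ (λ u v →
        (f 0 ∧ (g 0 ∧ h (suc n))) xor (u xor v)) (·-⊛-at (f 0) (tail g) h n) (⊛-assoc-at (tail f) g h n) ⟩
  (f 0 ∧ (g 0 ∧ h (suc n))) xor ((f 0 ∧ (tail g ⊛ h) n) xor (tail f ⊛ (g ⊛ h)) n)
    ≡⟨ xor-assoc (f 0 ∧ (g 0 ∧ h (suc n))) _ _ ⟨
  ((f 0 ∧ (g 0 ∧ h (suc n))) xor (f 0 ∧ (tail g ⊛ h) n)) xor (tail f ⊛ (g ⊛ h)) n
    ≡⟨ cong (_xor (tail f ⊛ (g ⊛ h)) n) (𝔽₂.distribˡ (f 0) _ _) ⟨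
  (f ⊛ (g ⊛ h)) (suc n) ∎
  where open ≡-Reasoning

⊛-zeroˡ-at : ∀ g n → (𝟘 ⊛ g) n ≡ false
⊛-zeroˡ-at g zero    = refl
⊛-zeroˡ-at g (suc n) = ⊛-zeroˡ-at g n

⊛-identityˡ-at : ∀ g n → (𝟙 ⊛ g) n ≡ g n
⊛-identityˡ-at g zero    = refl
⊛-identityˡ-at g (suc n) = trans (cong (g (suc n) xor_) (⊛-zeroˡ-at g n)) (xor-identityʳ _)

⊛-comm : ∀ f g → f ⊛ g ≈ g ⊛ f
⊛-comm f g = mk≈ (⊛-comm-at f g)

⊛-distribʳ : ∀ h f g → (f ⊕ g) ⊛ h ≈ f ⊛ h ⊕ g ⊛ h
⊛-distribʳ h f g = mk≈ (⊛-distribʳ-at h f g)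

⊛-distribˡ : ∀ h f g → h ⊛ (f ⊕ g) ≈ h ⊛ f ⊕ h ⊛ g
⊛-distribˡ h f g = ≈-trans (⊛-comm h (f ⊕ g))
  (≈-trans (⊛-distribʳ h f g) (⊕-cong (⊛-comm f h) (⊛-comm g h)))

⊛-identityˡ : ∀ g → 𝟙 ⊛ g ≈ g
⊛-identityˡ g = mk≈ (⊛-identityˡ-at g)

⊕-self : ∀ f → f ⊕ f ≈ 𝟘
⊕-self f = mk≈ λ n → xor-same (f n)

seriesRing : Algebra.Bundles.CommutativeRing 0ℓ 0ℓ
seriesRing = record
  { Carrier = Series ; _≈_ = _≈_ ; _+_ = _⊕_ ; _*_ = _⊛_ ; -_ = λ f → f ; 0# = 𝟘 ; 1# = 𝟙
  ; isCommutativeRing = record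
    { isRing = record
      { +-isAbelianGroup = record
        { isGroup = record
          { isMonoid = record
            { isSemigroup = record
              { isMagma = record
                { isEquivalence = Setoid.isEquivalence ≈-setoid
                ; ∙-cong = ⊕-cong
                }
              ; assoc = λ f g h → mk≈ λ n → xor-assoc (f n) (g n) (h n)
              }
            ; identity = (λ f → mk≈ λ n → refl) , (λ f → mk≈ λ n → xor-identityʳ (f n))
            }
          ; inverse = ⊕-self , ⊕-self
          ; ⁻¹-cong = λ p → p
          }
        ; comm = λ f g → mk≈ λ n → xor-comm (f n) (g n)
        }
      ; *-cong = ⊛-cong
      ; *-assoc = λ f g h → mk≈ (⊛-assoc-at f g h)
      ; *-identity = ⊛-identityˡ , λ g → ≈-trans (⊛-comm g 𝟙) (⊛-identityˡ g)
      ; distrib = ⊛-distribˡ , ⊛-distribʳ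
      }
    ; *-comm = ⊛-comm
    }
  }

private
  seriesACR : AlmostCommutativeRing 0ℓ 0ℓ
  seriesACR = fromCommutativeRing seriesRing

  -- Coefficients of solver polynomials are taken in 𝔽₂, so that normalisation knows x + x = 0 and
  -- hence (1 + x)² = 1 + x².
  constant : 𝔽₂.rawRing -Raw-AlmostCommutative⟶ seriesACR
  constant = record
    { ⟦_⟧    = _· 𝟙
    ; +-homo = λ x y → mk≈ λ n → 𝔽₂.distribʳ (𝟙 n) x y
    ; *-homo = λ x y → mk≈ λ n → trans (∧-assoc x y (𝟙 n))
                 (sym (trans (·-⊛-at x 𝟙 (y · 𝟙) n) (cong (x ∧_) (⊛-identityˡ-at (y · 𝟙) n))))
    ; -‿homo = λ x → ≈-refl
    ; 0-homo = ≈-refl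
    ; 1-homo = ≈-refl
    }

  constant-≟ : ∀ x y → Maybe (x · 𝟙 ≈ y · 𝟙)
  constant-≟ x y = Maybe.map (λ { refl → ≈-refl }) (dec⇒maybe (x Bool.≟ y))

open import Algebra.Solver.Ring 𝔽₂.rawRing seriesACR constant constant-≟
  using (solve; _:=_; _:+_; _:*_; con)

-- Congruence modulo q^{d+1}

infix 4 _≈[_]_

record _≈[_]_ (f : Series) (d : ℕ) (g : Series) : Set where
  constructor mk≈[]
  field at≤ : ∀ n → n ≤ d → f n ≡ g n
open _≈[_]_

≈[]-setoid : ℕ → Setoid 0ℓ 0ℓ
≈[]-setoid d = record
  { Carrier = Series ; _≈_ = _≈[ d ]_
  ; isEquivalence = record
    { refl  = mk≈[] λ _ _ → refl
    ; sym   = λ p → mk≈[] λ n n≤d → sym (at≤ p n n≤d)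
    ; trans = λ p q → mk≈[] λ n n≤d → trans (at≤ p n n≤d) (at≤ q n n≤d)
    }
  }

module ≈[] {d : ℕ} = Setoid (≈[]-setoid d)
module ≈[]-Reasoning (d : ℕ) where
  open import Relation.Binary.Reasoning.Setoid (≈[]-setoid d) public

≈⇒≈[] : ∀ {d f g} → f ≈ g → f ≈[ d ] g
≈⇒≈[] p = mk≈[] λ n _ → at p n

≈[]⇒≈ : ∀ {f g} → (∀ d → f ≈[ d ] g) → f ≈ g
≈[]⇒≈ p = mk≈ λ n → at≤ (p n) n ≤-refl

⊛-cong[] : ∀ {d f f′ g g′} → f ≈[ d ] f′ → g ≈[ d ] g′ → f ⊛ g ≈[ d ] f′ ⊛ g′
⊛-cong[] p q = mk≈[] λ n n≤d → ⊛-cong-at n λ i j i+j≡n → cong₂ _∧_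
  (at≤ p i (≤-trans (≤-trans (m≤m+n i j) (≤-reflexive i+j≡n)) n≤d))
  (at≤ q j (≤-trans (≤-trans (m≤n+m j i) (≤-reflexive i+j≡n)) n≤d))

⊕-cong[] : ∀ {d f f′ g g′} → f ≈[ d ] f′ → g ≈[ d ] g′ → f ⊕ g ≈[ d ] f′ ⊕ g′
⊕-cong[] p q = mk≈[] λ n n≤d → cong₂ _xor_ (at≤ p n n≤d) (at≤ q n n≤d)

-- Monomials and finite sums

q : ℕ → Series
q m n = m ≡ᵇ n

q-zero : q 0 ≈ 𝟙
q-zero = mk≈ λ { zero → refl ; (suc _) → refl }

q-+ : ∀ m n → q m ⊛ q n ≈ q (m + n)
q-+ zero    n = ≈-trans (⊛-cong q-zero ≈-refl) (⊛-identityˡ (q n))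
q-+ (suc m) n = mk≈ λ { zero → refl ; (suc k) → at (q-+ m n) k }

q-cong : ∀ {m n} → m ≡ n → q m ≈ q n
q-cong refl = ≈-refl

q-shift : ∀ m f n → (q m ⊛ f) (m + n) ≡ f n
q-shift zero    f n = trans (at (⊛-cong q-zero ≈-refl) n) (at (⊛-identityˡ f) n)
q-shift (suc m) f n = q-shift m f n

q-below : ∀ {m n} → n < m → q m n ≡ false
q-below {suc m} {zero}  _         = refl
q-below {suc m} {suc n} (s≤s n<m) = q-below n<m

q-high : ∀ {d m} → d < m → q m ≈[ d ] 𝟘
q-high d<m = mk≈[] λ n n≤d → q-below (≤-<-trans n≤d d<m)

1+q-high : ∀ {d m} → d < m → 𝟙 ⊕ q m ≈[ d ] 𝟙
1+q-high d<m = mk≈[] λ n n≤d →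
  trans (cong (𝟙 n xor_) (at≤ (q-high d<m) n n≤d)) (xor-identityʳ (𝟙 n))

Σ< : ℕ → (ℕ → Series) → Series
Σ< zero    f = 𝟘
Σ< (suc n) f = f 0 ⊕ Σ< n (f ∘ suc)

Σ-cong[] : ∀ {d} n {f g} → (∀ r → r < n → f r ≈[ d ] g r) → Σ< n f ≈[ d ] Σ< n g
Σ-cong[] zero    h = mk≈[] λ _ _ → refl
Σ-cong[] (suc n) h = ⊕-cong[] (h 0 (s≤s z≤n)) (Σ-cong[] n λ r r<n → h (suc r) (s≤s r<n))

Σ-cong : ∀ n {f g} → (∀ r → f r ≈ g r) → Σ< n f ≈ Σ< n g
Σ-cong zero    h = ≈-refl
Σ-cong (suc n) h = ⊕-cong (h 0) (Σ-cong n (h ∘ suc))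

Σ-last : ∀ n f → Σ< (suc n) f ≈ Σ< n f ⊕ f n
Σ-last zero    f = solve 1 (λ x → x :+ con false := con false :+ x) ≈-refl (f 0)
Σ-last (suc n) f = ≈-trans (⊕-congˡ (f 0) (Σ-last n (f ∘ suc)))
  (solve 3 (λ x y z → x :+ (y :+ z) := x :+ y :+ z) ≈-refl (f 0) (Σ< n (f ∘ suc)) (f (suc n)))

Σ-⊕ : ∀ n f g → Σ< n f ⊕ Σ< n g ≈ Σ< n (λ r → f r ⊕ g r)
Σ-⊕ zero    f g = ≈-refl
Σ-⊕ (suc n) f g = ≈-trans
  (solve 4 (λ w x y z → (w :+ x) :+ (y :+ z) := (w :+ y) :+ (x :+ z)) ≈-refl
    (f 0) (Σ< n (f ∘ suc)) (g 0) (Σ< n (g ∘ suc)))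
  (⊕-congˡ (f 0 ⊕ g 0) (Σ-⊕ n (f ∘ suc) (g ∘ suc)))

Σ-⊛ : ∀ n f g → Σ< n f ⊛ g ≈ Σ< n (λ r → f r ⊛ g)
Σ-⊛ zero    f g = mk≈ (⊛-zeroˡ-at g)
Σ-⊛ (suc n) f g = ≈-trans (⊛-distribʳ g (f 0) (Σ< n (f ∘ suc))) (⊕-congˡ (f 0 ⊛ g) (Σ-⊛ n (f ∘ suc) g))

-- The finite Jacobi triple product

-- ∏_{j<J} (1 + q^{Mj+c})
G : ℕ → ℕ → ℕ → Series
G M c zero    = 𝟙
G M c (suc J) = (𝟙 ⊕ q c) ⊛ G M (M + c) J

G-last : ∀ M c J → G M c (suc J) ≈ G M c J ⊛ (𝟙 ⊕ q (J * M + c))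
G-last M c zero    = ⊛-comm (𝟙 ⊕ q c) 𝟙
G-last M c (suc J) = begin
  (𝟙 ⊕ q c) ⊛ G M (M + c) (suc J)
    ≈⟨ ⊛-cong ≈-refl (G-last M (M + c) J) ⟩
  (𝟙 ⊕ q c) ⊛ (G M (M + c) J ⊛ (𝟙 ⊕ q (J * M + (M + c))))
    ≈⟨ solve 3 (λ x y z → x :* (y :* z) := x :* y :* z) ≈-refl (𝟙 ⊕ q c) (G M (M + c) J) _ ⟩
  G M c (suc J) ⊛ (𝟙 ⊕ q (J * M + (M + c)))
    ≈⟨ ⊛-cong ≈-refl (⊕-congˡ 𝟙 (q-cong (lemma J M c))) ⟩
  G M c (suc J) ⊛ (𝟙 ⊕ q (suc J * M + c)) ∎
  where
  open ≈-Reasoning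
  lemma : ∀ J M c → J * M + (M + c) ≡ M + J * M + c
  lemma = ℕ-Solver.solve-∀

-- [N choose r] in the variable q^M
gauss : ℕ → ℕ → ℕ → Series
gauss M N       zero    = 𝟙
gauss M zero    (suc r) = 𝟘
gauss M (suc N) (suc r) = gauss M N r ⊕ q (suc r * M) ⊛ gauss M N (suc r)

⊛-zeroʳ : ∀ f {g} → g ≈ 𝟘 → f ⊛ g ≈ 𝟘
⊛-zeroʳ f g≈𝟘 = ≈-trans (⊛-cong ≈-refl g≈𝟘) (solve 1 (λ x → x :* con false := con false) ≈-refl f)

gauss-above : ∀ M {N r} → N < r → gauss M N r ≈ 𝟘
gauss-above M {zero}  {suc r} _         = ≈-refl
gauss-above M {suc N} {suc r} (s≤s N<r) =
  ⊕-cong (gauss-above M N<r) (⊛-zeroʳ (q (suc r * M)) (gauss-above M (m≤n⇒m≤1+n N<r)))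

gauss-diag : ∀ M N → gauss M N N ≈ 𝟙
gauss-diag M zero    = ≈-refl
gauss-diag M (suc N) = ≈-trans
  (⊕-cong (gauss-diag M N) (⊛-zeroʳ (q (suc N * M)) (gauss-above M (n<1+n N))))
  (solve 0 (con true :+ con false := con true) ≈-refl)

-- The product formula for the Gaussian binomial with its denominator cleared; in characteristic 2
-- each 1 - q^{Mj} is 1 + q^{Mj}. After the recursion of `gauss`, the induction closes with (1 + u)
-- + u(1 + v) = 1 + uv.
gauss-product : ∀ M r s → gauss M (r + s) r ⊛ G M M r ≈ G M (suc s * M) r
gauss-product M zero    s       = ⊛-identityˡ 𝟙
gauss-product M (suc r) zero    rewrite +-identityʳ r | +-identityʳ M =
  ≈-trans (⊛-cong (gauss-diag M (suc r)) ≈-refl) (⊛-identityˡ (G M M (suc r)))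
gauss-product M (suc r) (suc s) = begin
  (gauss M (r + suc s) r ⊕ u ⊛ gauss M (r + suc s) (suc r)) ⊛ G M M (suc r)
    ≈⟨ ⊛-distribʳ (G M M (suc r)) (gauss M (r + suc s) r) _ ⟩
  gauss M (r + suc s) r ⊛ G M M (suc r) ⊕ u ⊛ gauss M (r + suc s) (suc r) ⊛ G M M (suc r)
    ≈⟨ ⊕-cong (⊛-cong ≈-refl (≈-trans (G-last M M r) (⊛-cong ≈-refl (⊕-congˡ 𝟙
        (q-cong (+-comm (r * M) M))))))
              (solve 3 (λ x y z → x :* y :* z := x :* (y :* z))
                ≈-refl u (gauss M (r + suc s) (suc r)) (G M M (suc r))) ⟩
  gauss M (r + suc s) r ⊛ (G M M r ⊛ (𝟙 ⊕ u)) ⊕ u ⊛ (gauss M (r + suc s) (suc r) ⊛ G M M (suc r))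
    ≈⟨ ⊕-cong (solve 3 (λ x y z → x :* (y :* z) := (x :* y) :* z)
        ≈-refl (gauss M (r + suc s) r) (G M M r) (𝟙 ⊕ u))
              (⊛-cong ≈-refl (≈-trans
                (⊛-cong (gauss-cong (+-suc r s)) ≈-refl) (gauss-product M (suc r) s))) ⟩
  (gauss M (r + suc s) r ⊛ G M M r) ⊛ (𝟙 ⊕ u) ⊕ u ⊛ ((𝟙 ⊕ v) ⊛ x)
    ≈⟨ ⊕-congʳ (u ⊛ ((𝟙 ⊕ v) ⊛ x)) (⊛-cong (gauss-product M r (suc s)) ≈-refl) ⟩
  x ⊛ (𝟙 ⊕ u) ⊕ u ⊛ ((𝟙 ⊕ v) ⊛ x)
    ≈⟨ solve 3 (λ u v x →
        x :* (con true :+ u) :+ u :* ((con true :+ v) :* x) := x :* (con true :+ u :* v)) ≈-refl u v x ⟩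
  x ⊛ (𝟙 ⊕ u ⊛ v)
    ≈⟨ ⊛-cong ≈-refl (⊕-congˡ 𝟙 (≈-trans (q-+ (suc r * M) (suc s * M)) (q-cong (lemma r s M)))) ⟩
  x ⊛ (𝟙 ⊕ q (r * M + suc (suc s) * M))
    ≈⟨ G-last M (suc (suc s) * M) r ⟨
  G M (suc (suc s) * M) (suc r) ∎
  where
  open ≈-Reasoning
  u = q (suc r * M)
  v = q (suc s * M)
  x = G M (suc (suc s) * M) r
  gauss-cong : ∀ {m n} → m ≡ n → gauss M m (suc r) ≈ gauss M n (suc r)
  gauss-cong refl = ≈-refl
  lemma : ∀ r s M → M + r * M + (M + s * M) ≡ r * M + (M + (M + s * M))
  lemma = ℕ-Solver.solve-∀

-- Mk(k-1)/2 + ck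
tri : ℕ → ℕ → ℕ → ℕ
tri M c zero    = 0
tri M c (suc k) = tri M c k + (k * M + c)

tri-shift : ∀ M c k → tri M (M + c) k ≡ tri M c k + k * M
tri-shift M c zero    = refl
tri-shift M c (suc k) = trans (cong (_+ (k * M + (M + c))) (tri-shift M c k)) (lemma (tri M c k) k M c)
  where
  lemma : ∀ t k M c → t + k * M + (k * M + (M + c)) ≡ t + (k * M + c) + (M + k * M)
  lemma = ℕ-Solver.solve-∀

-- The q-binomial theorem at z = q^c. Splitting off the first factor shifts `c` to `M + c`, which
-- multiplies the r-th term by q^{rM}; this is exactly the weight in the recursion of `gauss`.
cauchy : ∀ M c m → G M c m ≈ Σ< (suc m) (λ r → q (tri M c r) ⊛ gauss M m r)
cauchy M c zero    = begin
  𝟙                 ≈⟨ q-zero ⟨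
  q 0               ≈⟨ solve 1 (λ x → x := x :* con true :+ con false) ≈-refl (q 0) ⟩
  q 0 ⊛ 𝟙 ⊕ 𝟘       ∎
  where open ≈-Reasoning
cauchy M c (suc m) = begin
  (𝟙 ⊕ q c) ⊛ G M (M + c) m
    ≈⟨ ⊛-cong ≈-refl (cauchy M (M + c) m) ⟩
  (𝟙 ⊕ q c) ⊛ Σ< (suc m) t
    ≈⟨ solve 2 (λ x y → (con true :+ x) :* y := y :+ y :* x) ≈-refl (q c) (Σ< (suc m) t) ⟩
  Σ< (suc m) t ⊕ Σ< (suc m) t ⊛ q c
    ≈⟨ ⊕-cong (Σ-cong (suc m) t≈u) (≈-trans (Σ-⊛ (suc m) t (q c)) (Σ-cong (suc m) tq≈w)) ⟩
  Σ< (suc m) u ⊕ Σ< (suc m) w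
    ≈⟨ ⊕-congʳ (Σ< (suc m) w) extend ⟩
  u 0 ⊕ Σ< (suc m) (u ∘ suc) ⊕ Σ< (suc m) w
    ≈⟨ solve 3 (λ x y z → x :+ y :+ z := x :+ (z :+ y)) ≈-refl (u 0) (Σ< (suc m) (u ∘ suc)) (Σ< (suc m) w) ⟩
  u 0 ⊕ (Σ< (suc m) w ⊕ Σ< (suc m) (u ∘ suc))
    ≈⟨ ⊕-cong (⊛-cong ≈-refl (≈-trans (⊛-cong q-zero ≈-refl) (⊛-identityˡ 𝟙)))
        (≈-trans (Σ-⊕ (suc m) w (u ∘ suc)) (Σ-cong (suc m) λ r →
         ≈-sym (⊛-distribˡ (q (tri M c (suc r))) (gauss M m r) (q (suc r * M) ⊛ gauss M m (suc r))))) ⟩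
  Σ< (suc (suc m)) (λ r → q (tri M c r) ⊛ gauss M (suc m) r) ∎
  where
  open ≈-Reasoning
  t u w : ℕ → Series
  t r = q (tri M (M + c) r) ⊛ gauss M m r
  u r = q (tri M c r) ⊛ (q (r * M) ⊛ gauss M m r)
  w r = q (tri M c (suc r)) ⊛ gauss M m r

  t≈u : ∀ r → t r ≈ u r
  t≈u r = begin
    q (tri M (M + c) r) ⊛ gauss M m r              ≈⟨ ⊛-cong (q-cong (tri-shift M c r)) ≈-refl ⟩
    q (tri M c r + r * M) ⊛ gauss M m r            ≈⟨ ⊛-cong (q-+ (tri M c r) (r * M)) ≈-refl ⟨
    q (tri M c r) ⊛ q (r * M) ⊛ gauss M m r        ≈⟨ solve 3 (λ x y z →
      x :* y :* z := x :* (y :* z)) ≈-refl (q (tri M c r)) (q (r * M)) (gauss M m r) ⟩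
    u r ∎

  tq≈w : ∀ r → t r ⊛ q c ≈ w r
  tq≈w r = begin
    q (tri M (M + c) r) ⊛ gauss M m r ⊛ q c
      ≈⟨ solve 3 (λ x y z → x :* y :* z := x :* z :* y) ≈-refl (q (tri M (M + c) r)) (gauss M m r) (q c) ⟩
    q (tri M (M + c) r) ⊛ q c ⊛ gauss M m r
      ≈⟨ ⊛-cong (≈-trans (q-+ (tri M (M + c) r) c) (q-cong (trans
          (cong (_+ c) (tri-shift M c r)) (+-assoc (tri M c r) (r * M) c)))) ≈-refl ⟩
    w r ∎

  extend : Σ< (suc m) u ≈ u 0 ⊕ Σ< (suc m) (u ∘ suc)
  extend = begin
    Σ< (suc m) u               ≈⟨ solve 1 (λ x → x := x :+ con false) ≈-refl (Σ< (suc m) u) ⟩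
    Σ< (suc m) u ⊕ 𝟘           ≈⟨ ⊕-congˡ (Σ< (suc m) u) (⊛-zeroʳ (q (tri M c (suc m)))
      (⊛-zeroʳ (q (suc m * M)) (gauss-above M (n<1+n m)))) ⟨
    Σ< (suc m) u ⊕ u (suc m)   ≈⟨ Σ-last (suc m) u ⟨
    u 0 ⊕ Σ< (suc m) (u ∘ suc) ∎

-- The exponent Mk(k-1)/2 + ck, with M = a + c, at the integer k = r - n.
expo : ℕ → ℕ → ℕ → ℕ → ℕ
expo a c zero    r       = tri (a + c) c r
expo a c (suc n) zero    = tri (a + c) a (suc n)
expo a c (suc n) (suc r) = expo a c n r

expo-zero : ∀ a c n → expo a c n 0 ≡ tri (a + c) a n
expo-zero a c zero    = refl
expo-zero a c (suc n) = refl

-- The exponent grows by Mk + c from k to k + 1. Since k = r - n may be negative, nM is moved to the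
-- other side.
expo-suc : ∀ a c n r → expo a c n (suc r) + n * (a + c) ≡ expo a c n r + (r * (a + c) + c)
expo-suc a c zero    r       = +-identityʳ _
expo-suc a c (suc n) zero    rewrite expo-zero a c n = lemma (tri (a + c) a n) n a c
  where
  lemma : ∀ t n a c → t + ((a + c) + n * (a + c)) ≡ t + (n * (a + c) + a) + c
  lemma = ℕ-Solver.solve-∀
expo-suc a c (suc n) (suc r) = begin
  expo a c n (suc r) + (a + c + n * (a + c))       ≡⟨ lemma₁ (expo a c n (suc r)) (a + c) (n * (a + c)) ⟩
  (a + c) + (expo a c n (suc r) + n * (a + c))     ≡⟨ cong (λ e → (a + c) + e) (expo-suc a c n r) ⟩
  (a + c) + (expo a c n r + (r * (a + c) + c))     ≡⟨ lemma₂ (a + c) (expo a c n r) (r * (a + c)) c ⟩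
  expo a c n r + (a + c + r * (a + c) + c)         ∎
  where
  open ≡-Reasoning
  lemma₁ : ∀ x y z → x + (y + z) ≡ y + (x + z)
  lemma₁ = ℕ-Solver.solve-∀
  lemma₂ : ∀ x y z c → x + (y + (z + c)) ≡ y + (x + z + c)
  lemma₂ = ℕ-Solver.solve-∀

-- Induction on `n`, starting from the q-binomial theorem. The new factor 1 + y adds a copy of the
-- sum displaced by one index; the recursion of `gauss` merges the two copies, and the displaced
-- term at `r = 0` becomes the new first term.
finite-jtp : ∀ a c m n → G (a + c) c m ⊛ G (a + c) a n ≈
             Σ< (suc (n + m)) (λ r → q (expo a c n r) ⊛ gauss (a + c) (n + m) r)
finite-jtp a c m zero    = ≈-trans
  (solve 1 (λ x → x :* con true := x) ≈-refl (G (a + c) c m)) (cauchy (a + c) c m)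
finite-jtp a c m (suc n) = begin
  G M c m ⊛ G M a (suc n)
    ≈⟨ ⊛-cong ≈-refl (G-last M a n) ⟩
  G M c m ⊛ (G M a n ⊛ (𝟙 ⊕ y))
    ≈⟨ solve 3 (λ u v y → u :* (v :* (con true :+ y)) := u :* v :+ u :* v :* y)
        ≈-refl (G M c m) (G M a n) y ⟩
  G M c m ⊛ G M a n ⊕ G M c m ⊛ G M a n ⊛ y
    ≈⟨ ⊕-cong (finite-jtp a c m n) (≈-trans (⊛-cong (finite-jtp a c m n) ≈-refl) (Σ-⊛ (suc N) v y)) ⟩
  Σ< (suc N) v ⊕ (v 0 ⊛ y ⊕ Σ< N (λ r → v (suc r) ⊛ y))
    ≈⟨ ⊕-congˡ (Σ< (suc N) v) (⊕-cong head (≈-trans (Σ-cong N vy≈w) extend)) ⟩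
  Σ< (suc N) v ⊕ (q (tri M a (suc n)) ⊛ 𝟙 ⊕ Σ< (suc N) w)
    ≈⟨ solve 3 (λ x y z → x :+ (y :+ z) := y :+ (x :+ z))
        ≈-refl (Σ< (suc N) v) (q (tri M a (suc n)) ⊛ 𝟙) (Σ< (suc N) w) ⟩
  q (tri M a (suc n)) ⊛ 𝟙 ⊕ (Σ< (suc N) v ⊕ Σ< (suc N) w)
    ≈⟨ ⊕-congˡ (q (tri M a (suc n)) ⊛ 𝟙) (≈-trans (Σ-⊕ (suc N) v w) (Σ-cong (suc N) λ r →
         ≈-sym (⊛-distribˡ (q (expo a c n r)) (gauss M N r) (q (suc r * M) ⊛ gauss M N (suc r))))) ⟩
  Σ< (suc (suc N)) (λ r → q (expo a c (suc n) r) ⊛ gauss M (suc N) r) ∎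
  where
  open ≈-Reasoning
  M = a + c
  N = n + m
  y = q (n * M + a)
  v w : ℕ → Series
  v r = q (expo a c n r) ⊛ gauss M N r
  w r = q (expo a c n r) ⊛ (q (suc r * M) ⊛ gauss M N (suc r))

  head : v 0 ⊛ y ≈ q (tri M a (suc n)) ⊛ 𝟙
  head = begin
    q (expo a c n 0) ⊛ 𝟙 ⊛ y  ≈⟨ solve 2 (λ x y → x :* con true :* y := x :* y :* con true)
      ≈-refl (q (expo a c n 0)) y ⟩
    q (expo a c n 0) ⊛ y ⊛ 𝟙  ≈⟨ ⊛-cong (≈-trans (q-+ (expo a c n 0) (n * M + a)) (q-cong
      (cong (_+ (n * M + a)) (expo-zero a c n)))) ≈-refl ⟩
    q (tri M a (suc n)) ⊛ 𝟙   ∎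

  exponent : ∀ r → expo a c n (suc r) + (n * M + a) ≡ expo a c n r + suc r * M
  exponent r = trans (sym (+-assoc (expo a c n (suc r)) (n * M) a))
    (trans (cong (_+ a) (expo-suc a c n r)) (lemma (expo a c n r) (r * M) a c))
    where
    lemma : ∀ x y a c → x + (y + c) + a ≡ x + (a + c + y)
    lemma = ℕ-Solver.solve-∀

  vy≈w : ∀ r → v (suc r) ⊛ y ≈ w r
  vy≈w r = begin
    q (expo a c n (suc r)) ⊛ g ⊛ y       ≈⟨ solve 3 (λ x g y → x :* g :* y := x :* y :* g)
      ≈-refl (q (expo a c n (suc r))) g y ⟩
    q (expo a c n (suc r)) ⊛ y ⊛ g       ≈⟨ ⊛-cong
      (≈-trans (q-+ (expo a c n (suc r)) (n * M + a)) (q-cong (exponent r))) ≈-refl ⟩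
    q (expo a c n r + suc r * M) ⊛ g     ≈⟨ ⊛-cong (q-+ (expo a c n r) (suc r * M)) ≈-refl ⟨
    q (expo a c n r) ⊛ q (suc r * M) ⊛ g ≈⟨ solve 3 (λ x y z → x :* y :* z := x :* (y :* z))
      ≈-refl (q (expo a c n r)) (q (suc r * M)) g ⟩
    w r ∎
    where g = gauss M N (suc r)

  extend : Σ< N w ≈ Σ< (suc N) w
  extend = begin
    Σ< N w        ≈⟨ solve 1 (λ x → x := x :+ con false) ≈-refl (Σ< N w) ⟩
    Σ< N w ⊕ 𝟘    ≈⟨ ⊕-congˡ (Σ< N w) (⊛-zeroʳ (q (expo a c n N))
      (⊛-zeroʳ (q (suc N * M)) (gauss-above M (n<1+n N)))) ⟨
    Σ< N w ⊕ w N  ≈⟨ Σ-last N w ⟨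
    Σ< (suc N) w  ∎

-- The infinite product

-- For M, c > 0 the factors with j ≥ n do not affect the coefficient of qⁿ; otherwise a junk value.
G∞ : ℕ → ℕ → Series
G∞ M c n = G M c n n

G-step : ∀ {d} M c J → d < J * M + c → G M c (suc J) ≈[ d ] G M c J
G-step {d} M c J d< = ≈[].trans (≈⇒≈[] (G-last M c J))
  (≈[].trans (⊛-cong[] ≈[].refl (1+q-high d<)) (≈⇒≈[]
    (≈-trans (⊛-comm (G M c J) 𝟙) (⊛-identityˡ (G M c J)))))

G-stable : ∀ M c .{{_ : NonZero M}} .{{_ : NonZero c}} k n → G M c (k + n) n ≡ G M c n n
G-stable M c zero    n = refl
G-stable M c {{mnz}} {{cnz}} (suc k) n = trans (at≤ (G-step M c (k + n) n<) n ≤-refl) (G-stable M c {{mnz}} {{cnz}} k n)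
  where
  n< : n < (k + n) * M + c
  n< = ≤-<-trans (≤-trans (m≤n+m n k) (m≤m*n (k + n) M)) (m<m+n _ (>-nonZero⁻¹ c))

G≈G∞ : ∀ M c .{{_ : NonZero M}} .{{_ : NonZero c}} {d J} → d ≤ J → G M c J ≈[ d ] G∞ M c
G≈G∞ M c {{mnz}} {{cnz}} {d} {J} d≤J = mk≈[] λ n n≤d →
  subst (λ j → G M c j n ≡ G∞ M c n) (m∸n+n≡m (≤-trans n≤d d≤J)) (G-stable M c {{mnz}} {{cnz}} (J ∸ n) n)

G-high : ∀ {d} M c J → d < c → G M c J ≈[ d ] 𝟙
G-high M c zero    d<c = mk≈[] λ _ _ → refl
G-high {d} M c (suc J) d<c = ≈[].trans
  (⊛-cong[] (1+q-high d<c) (G-high M (M + c) J (<-≤-trans d<c (m≤n+m c M)))) (≈⇒≈[] (⊛-identityˡ 𝟙))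

k≤tri : ∀ M c .{{_ : NonZero c}} k → k ≤ tri M c k
k≤tri M c zero    = z≤n
k≤tri M c (suc k) = subst (_≤ tri M c k + (k * M + c)) (+-comm k 1)
  (+-mono-≤ (k≤tri M c k) (≤-trans (>-nonZero⁻¹ c) (m≤n+m c (k * M))))

-- Together with `n≤r+expo`: the exponent at k = r - n is at least |k|, so an exponent at most d
-- confines `r` to distance d from the centre `n`.
r≤n+expo : ∀ a c .{{_ : NonZero c}} n r → r ≤ n + expo a c n r
r≤n+expo a c zero    r       = k≤tri (a + c) c r
r≤n+expo a c (suc n) zero    = z≤n
r≤n+expo a c (suc n) (suc r) = s≤s (r≤n+expo a c n r)

n≤r+expo : ∀ a c .{{_ : NonZero a}} n r → n ≤ r + expo a c n r
n≤r+expo a c zero    r       = z≤n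
n≤r+expo a c (suc n) zero    = k≤tri (a + c) a (suc n)
n≤r+expo a c (suc n) (suc r) = s≤s (n≤r+expo a c n r)

module _ (a c : ℕ) .{{a≢0 : NonZero a}} .{{c≢0 : NonZero c}} .{{M≢0 : NonZero (a + c)}} where
  private M = a + c

  -- Far from both ends of its row the Gaussian binomial is 1 / ∏ (1 + q^{Mj}) up to degree d: by
  -- `gauss-product` what remains is a product whose exponents are at least (N - r + 1)M, hence
  -- exceed d.
  gauss-limit : ∀ {d r N} → d ≤ r → r + d ≤ N → gauss M N r ⊛ G∞ M M ≈[ d ] 𝟙
  gauss-limit {d} {r} {N} d≤r r+d≤N = begin
    gauss M N r ⊛ G∞ M M            ≈⟨ ⊛-cong[] ≈[].refl (G≈G∞ M M d≤r) ⟨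
    gauss M N r ⊛ G M M r           ≡⟨ cong (λ n → gauss M n r ⊛ G M M r) (m+[n∸m]≡n r≤N) ⟨
    gauss M (r + s) r ⊛ G M M r     ≈⟨ ≈⇒≈[] (gauss-product M r s) ⟩
    G M (suc s * M) r               ≈⟨ G-high M (suc s * M) r d< ⟩
    𝟙                               ∎
    where
    open ≈[]-Reasoning d
    r≤N = ≤-trans (m≤m+n r d) r+d≤N
    s = N ∸ r
    d< : d < suc s * M
    d< = ≤-trans (s≤s (m+n≤o⇒m≤o∸n d (subst (_≤ N) (+-comm r d) r+d≤N))) (m≤m*n (suc s) M)

  jtp : ∀ d → G∞ M c ⊛ G∞ M a ⊛ G∞ M M ≈[ d ]
              Σ< (suc (d + d + (d + d))) (q ∘ expo a c (d + d))
  jtp d = begin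
    G∞ M c ⊛ G∞ M a ⊛ G∞ M M
      ≈⟨ ⊛-cong[] (⊛-cong[] (G≈G∞ M c d≤J) (G≈G∞ M a d≤J)) ≈[].refl ⟨
    G M c J ⊛ G M a J ⊛ G∞ M M
      ≈⟨ ≈⇒≈[] (⊛-cong (finite-jtp a c J J) ≈-refl) ⟩
    Σ< (suc (J + J)) (λ r → q (expo a c J r) ⊛ gauss M (J + J) r) ⊛ G∞ M M
      ≈⟨ ≈⇒≈[] (Σ-⊛ (suc (J + J)) (λ r → q (expo a c J r) ⊛ gauss M (J + J) r) (G∞ M M)) ⟩
    Σ< (suc (J + J)) (λ r → q (expo a c J r) ⊛ gauss M (J + J) r ⊛ G∞ M M)
      ≈⟨ Σ-cong[] (suc (J + J)) (λ r _ → ≈[].trans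
           (≈⇒≈[] (solve 3 (λ x y z → x :* y :* z := x :* (y :* z))
             ≈-refl (q (expo a c J r)) (gauss M (J + J) r) (G∞ M M)))
           (term r)) ⟩
    Σ< (suc (J + J)) (q ∘ expo a c J) ∎
    where
    open ≈[]-Reasoning d
    -- Indices whose exponent is at most `d` lie within `d` of the centre `J`. With `J = d + d` they
    -- satisfy `d ≤ r` and `r + d ≤ J + J`, as `gauss-limit` demands.
    J = d + d
    d≤J = m≤m+n d d
    term : ∀ r → q (expo a c J r) ⊛ (gauss M (J + J) r ⊛ G∞ M M) ≈[ d ] q (expo a c J r)
    term r with expo a c J r ≤? d
    ... | yes e≤d = ≈[].trans (⊛-cong[] ≈[].refl (gauss-limit
            (+-cancelʳ-≤ d d r (≤-trans (n≤r+expo a c J r) (+-monoʳ-≤ r e≤d)))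
            (≤-trans (+-monoˡ-≤ d
              (≤-trans (r≤n+expo a c J r) (+-monoʳ-≤ J e≤d))) (≤-reflexive (+-assoc J d d)))))
            (≈⇒≈[] (≈-trans (⊛-comm (q (expo a c J r)) 𝟙) (⊛-identityˡ (q (expo a c J r)))))
    ... | no  e≰d = ≈[].trans
            (≈[].trans (⊛-cong[] (q-high (≰⇒> e≰d)) ≈[].refl) (≈⇒≈[]
              (mk≈ (⊛-zeroˡ-at (gauss M (J + J) r ⊛ G∞ M M)))))
            (≈[].sym (q-high (≰⇒> e≰d)))

-- Theta series

Square : ℕ → Set
Square n = ∃ λ x → x * x ≡ n

square? : Decidable Square
square? n = map′ (λ (x , _ , eq) → x , eq) (λ (x , eq) → x , s≤s (bound x eq) , eq)
              (anyUpTo? (λ x → x * x ≟ n) (suc n))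
  where
  bound : ∀ x → x * x ≡ n → x ≤ n
  bound zero    eq = z≤n
  bound (suc x) eq = subst (suc x ≤_) eq (m≤m*n (suc x) (suc x))

opaque
  sq : ℕ → Bool
  sq n = does (square? n)

  sq-true : ∀ {n} → Square n → sq n ≡ true
  sq-true {n} = dec-true (square? n)

  sq-false : ∀ {n} → ¬ Square n → sq n ≡ false
  sq-false {n} = dec-false (square? n)

  sq-true⁻ : ∀ {n} → sq n ≡ true → Square n
  sq-true⁻ {n} eq = case square? n of λ where
    (yes p) → p
    (no ¬p) → contradiction (trans (sym eq) (dec-false (square? n) ¬p)) λ ()

  sq-cong : ∀ {m n} → (Square m → Square n) → (Square n → Square m) → sq m ≡ sq n
  sq-cong {m} {n} f g = does-⇔ (mk⇔ f g) (square? m) (square? n)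

square-injective : ∀ {m n} → m * m ≡ n * n → m ≡ n
square-injective {m} {n} eq with <-cmp m n
... | tri< m<n _ _ = contradiction eq (<⇒≢ (*-mono-< m<n m<n))
... | tri≈ _ m≡n _ = m≡n
... | tri> _ _ n<m = contradiction (sym eq) (<⇒≢ (*-mono-< n<m n<m))

q-diag : ∀ n → q n n ≡ true
q-diag zero    = refl
q-diag (suc n) = q-diag n

q-off : ∀ {m n} → m ≢ n → q m n ≡ false
q-off {zero}  {zero}  m≢n = contradiction refl m≢n
q-off {zero}  {suc n} m≢n = refl
q-off {suc m} {zero}  m≢n = refl
q-off {suc m} {suc n} m≢n = q-off (m≢n ∘ cong suc)

Σq-none : ∀ N (e : ℕ → ℕ) {n} → (∀ r → e r ≢ n) → Σ< N (q ∘ e) n ≡ false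
Σq-none zero    e h = refl
Σq-none (suc N) e h = cong₂ _xor_ (q-off (h 0)) (Σq-none N (e ∘ suc) (h ∘ suc))

Σq-one : ∀ {N} (e : ℕ → ℕ) {n r₀} → r₀ < N → e r₀ ≡ n → (∀ r → e r ≡ n → r ≡ r₀) → Σ< N (q ∘ e) n ≡ true
Σq-one {suc N} e {r₀ = zero} _ refl h =
  cong₂ _xor_ (q-diag (e 0)) (Σq-none N (e ∘ suc) (λ r eq → 1+n≢0 (h (suc r) eq)))
Σq-one {suc N} e {r₀ = suc r₀} (s≤s r₀<N) eq h =
  cong₂ _xor_ (q-off {e 0} λ eq₀ → 1+n≢0 (sym (h 0 eq₀)))
    (Σq-one (e ∘ suc) r₀<N eq (λ r eq′ → suc-injective (h (suc r) eq′)))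

expo-⁺ : ∀ a c n k → expo a c n (n + k) ≡ tri (a + c) c k
expo-⁺ a c zero    k = refl
expo-⁺ a c (suc n) k = expo-⁺ a c n k

expo-⁻ : ∀ a c r k → expo a c (r + suc k) r ≡ tri (a + c) a (suc k)
expo-⁻ a c zero    k = refl
expo-⁻ a c (suc r) k = expo-⁻ a c r k

θ : ℕ → Series
θ t n = sq (t * n + 1)

-- Under these conditions te + 1 = (sk ± 1)² for the exponents e of the triple product, and every
-- square root of a number tn + 1 has the form sk ± 1.
record Completion (a c s′ t : ℕ) : Set where
  s = suc s′
  field
    sum≡    : t * (a + c) ≡ 2 * (s * s)
    right≡  : t * c ≡ s * s + 2 * s
    left≡   : t * a + 1 ≡ s′ * s′
    1<s′    : 1 < s′
    roots   : ∀ x n → x * x ≡ t * n + 1 → ∃ λ k → x ≡ 1 + k * s ⊎ x ≡ s′ + k * s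

module Theta (a c s′ t : ℕ) .{{a≢0 : NonZero a}} .{{c≢0 : NonZero c}} .{{M≢0 : NonZero (a + c)}} .{{t≢0 : NonZero t}}
             (completion : Completion a c s′ t) where
  open Completion completion
  private M = a + c

  tri⁺ : ∀ k → t * tri M c k + 1 ≡ (1 + k * s) * (1 + k * s)
  tri⁺ zero    = cong (_+ 1) (*-zeroʳ t)
  tri⁺ (suc k) = begin
    t * (tri M c k + (k * M + c)) + 1           ≡⟨ lemma₁ t (tri M c k) k M c ⟩
    (t * tri M c k + 1) + k * (t * M) + t * c   ≡⟨ cong₂ _+_ (cong₂ (λ x y →
      x + k * y) (tri⁺ k) sum≡) right≡ ⟩
    (1 + k * s) * (1 + k * s) + k * (2 * (s * s)) + (s * s + 2 * s) ≡⟨ lemma₂ k s ⟩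
    (1 + (s + k * s)) * (1 + (s + k * s))       ∎
    where
    open ≡-Reasoning
    lemma₁ : ∀ t x k M c → t * (x + (k * M + c)) + 1 ≡ (t * x + 1) + k * (t * M) + t * c
    lemma₁ = ℕ-Solver.solve-∀
    lemma₂ : ∀ k s → (1 + k * s) * (1 + k * s) + k * (2 * (s * s)) + (s * s + 2 * s)
      ≡ (1 + (s + k * s)) * (1 + (s + k * s))
    lemma₂ = ℕ-Solver.solve-∀

  tri⁻ : ∀ k → t * tri M a (suc k) + 1 ≡ (s′ + k * s) * (s′ + k * s)
  tri⁻ zero    = trans left≡ (cong₂ _*_ (sym (+-identityʳ s′)) (sym (+-identityʳ s′)))
  tri⁻ (suc k) = +-cancelʳ-≡ 1 _ _ (begin
    t * (tri M a (suc k) + (suc k * M + a)) + 1 + 1         ≡⟨ lemma₁ t (tri M a (suc k)) k M a ⟩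
    (t * tri M a (suc k) + 1) + suc k * (t * M) + (t * a + 1) ≡⟨ cong₂ _+_ (cong₂ (λ x y →
      x + suc k * y) (tri⁻ k) sum≡) left≡ ⟩
    (s′ + k * s) * (s′ + k * s) + suc k * (2 * (s * s)) + s′ * s′ ≡⟨ lemma₂ k s′ ⟩
    (s′ + (s + k * s)) * (s′ + (s + k * s)) + 1             ∎)
    where
    open ≡-Reasoning
    lemma₁ : ∀ t x k M a → t * (x + ((1 + k) * M + a)) + 1 + 1
      ≡ (t * x + 1) + (1 + k) * (t * M) + (t * a + 1)
    lemma₁ = ℕ-Solver.solve-∀
    lemma₂ : ∀ k s′ →
      (s′ + k * (1 + s′)) * (s′ + k * (1 + s′)) + (1 + k) * (2 * ((1 + s′) * (1 + s′))) + s′ * s′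
                    ≡ (s′ + (1 + s′ + k * (1 + s′))) * (s′ + (1 + s′ + k * (1 + s′))) + 1
    lemma₂ = ℕ-Solver.solve-∀

  -- The absolute value of 1 + sk at k = r - n, split by the sign of k as in `expo`.
  root : ℕ → ℕ → ℕ
  root zero    r       = 1 + r * s
  root (suc n) zero    = s′ + n * s
  root (suc n) (suc r) = root n r

  expo-root : ∀ n r → t * expo a c n r + 1 ≡ root n r * root n r
  expo-root zero    r       = tri⁺ r
  expo-root (suc n) zero    = tri⁻ n
  expo-root (suc n) (suc r) = expo-root n r

  -- The residues 1 and -1 modulo s differ because `1 < s′`. If they coincided, exponents for k ≥ 0
  -- and k < 0 could be equal and cancel modulo 2.
  residues : ∀ r k → 1 + r * s ≢ s′ + k * s
  residues r k eq = <⇒≢ 1<s′ (trans (sym (mod 1 r (m≤n⇒m≤1+n 1<s′))) (trans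
    (cong (_% s) eq) (mod s′ k (n<1+n s′))))
    where
    mod : ∀ i k → i < s → (i + k * s) % s ≡ i
    mod i k i<s = trans ([m+kn]%n≡m%n i k s) (m<n⇒m%n≡m i<s)

  root-≢ : ∀ n r k → n ≤ k → root n r ≢ s′ + k * s
  root-≢ zero    r       k n≤k eq = residues r k eq
  root-≢ (suc n) zero    k n<k eq = <⇒≢ n<k (*-cancelʳ-≡ n k s (+-cancelˡ-≡ s′ _ _ eq))
  root-≢ (suc n) (suc r) k n<k eq = root-≢ n r k (<⇒≤ n<k) eq

  root-injective : ∀ n r r′ → root n r ≡ root n r′ → r ≡ r′
  root-injective zero    r       r′       eq = *-cancelʳ-≡ r r′ s (suc-injective eq)
  root-injective (suc n) zero    zero     eq = refl
  root-injective (suc n) zero    (suc r′) eq = contradiction (sym eq) (root-≢ n r′ n ≤-refl)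
  root-injective (suc n) (suc r) zero     eq = contradiction eq (root-≢ n r n ≤-refl)
  root-injective (suc n) (suc r) (suc r′) eq = cong suc (root-injective n r r′ eq)

  -- Completing the square turns equal exponents into equal roots. As every exponent occurs once, no
  -- terms cancel modulo 2 and the sum is an indicator series.
  expo-injective : ∀ n r r′ → expo a c n r ≡ expo a c n r′ → r ≡ r′
  expo-injective n r r′ eq = root-injective n r r′ (square-injective
    (trans (sym (expo-root n r)) (trans (cong (λ e → t * e + 1) eq) (expo-root n r′))))

  expo-surjective : ∀ {n J} → n ≤ J → Square (t * n + 1) → ∃ λ r → r < suc (J + J) × expo a c J r ≡ n
  expo-surjective {n} {J} n≤J (x , x²≡) with roots x n x²≡
  ... | k , inj₁ refl = J + k , s≤s (+-monoʳ-≤ J (≤-trans k≤n n≤J)) , trans (expo-⁺ a c J k) tri≡n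
    where
    tri≡n : tri M c k ≡ n
    tri≡n = *-cancelˡ-≡ _ _ t (+-cancelʳ-≡ 1 _ _ (trans (tri⁺ k) x²≡))
    k≤n : k ≤ n
    k≤n = subst (k ≤_) tri≡n (k≤tri M c k)
  ... | k , inj₂ refl = J ∸ suc k , s≤s (≤-trans (m∸n≤m J (suc k)) (m≤m+n J J)) ,
        trans (cong (λ j → expo a c j (J ∸ suc k)) (sym (m∸n+n≡m k<J)))
          (trans (expo-⁻ a c (J ∸ suc k) k) tri≡n)
    where
    tri≡n : tri M a (suc k) ≡ n
    tri≡n = *-cancelˡ-≡ _ _ t (+-cancelʳ-≡ 1 _ _ (trans (tri⁻ k) x²≡))
    k<J : k < J
    k<J = ≤-trans (subst (k <_) tri≡n (k≤tri M a (suc k))) n≤J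

  Σ≡θ : ∀ {n J} → n ≤ J → Σ< (suc (J + J)) (q ∘ expo a c J) n ≡ θ t n
  Σ≡θ {n} {J} n≤J = case square? (t * n + 1) of λ where
    (yes p) → let r₀ , r₀< , eq = expo-surjective n≤J p in
      trans (Σq-one (expo a c J) r₀< eq (λ r eq′ → expo-injective J r r₀ (trans eq′ (sym eq))))
            (sym (sq-true p))
    (no ¬p) → trans (Σq-none (suc (J + J)) (expo a c J)
      (λ r eq → ¬p (root J r , trans (sym (expo-root J r)) (cong (λ e → t * e + 1) eq))))
            (sym (sq-false ¬p))

  product≈θ : G∞ M c ⊛ G∞ M a ⊛ G∞ M M ≈ θ t
  product≈θ = ≈[]⇒≈ λ d → mk≈[] λ n n≤d →
    trans (at≤ (jtp a c d) n n≤d) (Σ≡θ (≤-trans n≤d (m≤m+n d d)))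

-- When t is a multiple of s, x² = tn + 1 gives x² ≡ 1 modulo s. For the moduli 6, 4 and 3 in use, a
-- finite check leaves only the residues 1 and -1.
roots-mod : ∀ s′ t′ → (∀ {i} → i < suc s′ → i * i % suc s′ ≡ 1 % suc s′ → i ≡ 1 ⊎ i ≡ s′) →
            ∀ x n → x * x ≡ t′ * suc s′ * n + 1 → ∃ λ k → x ≡ 1 + k * suc s′ ⊎ x ≡ s′ + k * suc s′
roots-mod s′ t′ check x n eq = x / s , go (check (m%n<n x s) residue)
  where
  s = suc s′
  residue : (x % s) * (x % s) % s ≡ 1 % s
  residue = begin
    (x % s) * (x % s) % s   ≡⟨ %-distribˡ-* x x s ⟨
    x * x % s               ≡⟨ cong (_% s) (trans eq (lemma t′ s n)) ⟩
    (1 + t′ * n * s) % s    ≡⟨ [m+kn]%n≡m%n 1 (t′ * n) s ⟩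
    1 % s                   ∎
    where
    open ≡-Reasoning
    lemma : ∀ t s n → t * s * n + 1 ≡ 1 + t * n * s
    lemma = ℕ-Solver.solve-∀
  go : x % s ≡ 1 ⊎ x % s ≡ s′ → x ≡ 1 + x / s * s ⊎ x ≡ s′ + x / s * s
  go (inj₁ i) = inj₁ (trans (m≡m%n+[m/n]*n x s) (cong (_+ x / s * s) i))
  go (inj₂ i) = inj₂ (trans (m≡m%n+[m/n]*n x s) (cong (_+ x / s * s) i))

roots? : ∀ s′ → Dec (∀ {i} → i < suc s′ → i * i % suc s′ ≡ 1 % suc s′ → i ≡ 1 ⊎ i ≡ s′)
roots? s′ = allUpTo? (λ i → (i * i % suc s′ ≟ 1 % suc s′) →-dec ((i ≟ 1) ⊎-dec (i ≟ s′))) (suc s′)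

pentagonal : G∞ 3 2 ⊛ G∞ 3 1 ⊛ G∞ 3 3 ≈ θ 24
pentagonal = Theta.product≈θ 1 2 5 24 record
  { sum≡ = refl ; right≡ = refl ; left≡ = refl ; 1<s′ = s≤s (s≤s z≤n) ; roots = roots-mod 5 4
    (from-yes (roots? 5)) }

triangular : G∞ 4 3 ⊛ G∞ 4 1 ⊛ G∞ 4 4 ≈ θ 8
triangular = Theta.product≈θ 1 3 3 8 record
  { sum≡ = refl ; right≡ = refl ; left≡ = refl ; 1<s′ = s≤s (s≤s z≤n) ; roots = roots-mod 3 2
    (from-yes (roots? 3)) }

octagonal : G∞ 6 5 ⊛ G∞ 6 1 ⊛ G∞ 6 6 ≈ θ 3
octagonal = Theta.product≈θ 1 5 2 3 record
  { sum≡ = refl ; right≡ = refl ; left≡ = refl ; 1<s′ = s≤s (s≤s z≤n) ; roots = roots-mod 2 1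
    (from-yes (roots? 2)) }

-- Product identities

-- Since f has constant term 1, the constant term of g vanishes; then f times the tail of g vanishes
-- too, and the argument repeats.
⊛-zero-divisor : ∀ f g → f 0 ≡ true → f ⊛ g ≈ 𝟘 → ∀ n → g n ≡ false
⊛-zero-divisor f g f₀ fg≈𝟘 zero    = trans (cong (_∧ g 0) (sym f₀)) (at fg≈𝟘 0)
⊛-zero-divisor f g f₀ fg≈𝟘 (suc n) = ⊛-zero-divisor f (tail g) f₀ (mk≈ shifted) n
  where
  shifted : ∀ k → (f ⊛ tail g) k ≡ false
  shifted k = begin
    (f ⊛ tail g) k                         ≡⟨ xor-identityʳ _ ⟨
    (f ⊛ tail g) k xor false               ≡⟨ cong ((f ⊛ tail g) k xor_) (trans
      (cong (f (suc k) ∧_) (⊛-zero-divisor f g f₀ fg≈𝟘 zero)) (∧-zeroʳ (f (suc k)))) ⟨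
    (f ⊛ tail g) k xor (f (suc k) ∧ g 0)   ≡⟨ ⊛-tailʳ f g k ⟨
    (f ⊛ g) (suc k)                        ≡⟨ at fg≈𝟘 (suc k) ⟩
    false                                  ∎
    where open ≡-Reasoning

⊛-cancelˡ : ∀ f {g h} → f 0 ≡ true → f ⊛ g ≈ f ⊛ h → g ≈ h
⊛-cancelˡ f {g} {h} f₀ eq = begin
  g            ≈⟨ solve 2 (λ g h → g := (g :+ h) :+ h) ≈-refl g h ⟩
  (g ⊕ h) ⊕ h  ≈⟨ ⊕-congʳ h (mk≈ (⊛-zero-divisor f (g ⊕ h) f₀ f[g+h]≈𝟘)) ⟩
  𝟘 ⊕ h        ≈⟨ mk≈ (λ _ → refl) ⟩
  h            ∎
  where
  open ≈-Reasoning
  f[g+h]≈𝟘 : f ⊛ (g ⊕ h) ≈ 𝟘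
  f[g+h]≈𝟘 = ≈-trans (⊛-distribˡ f g h) (≈-trans (⊕-congʳ (f ⊛ h) eq) (⊕-self (f ⊛ h)))

G-cong : ∀ M {c c′} → c ≡ c′ → ∀ J → G M c J ≈ G M c′ J
G-cong M refl J = ≈-refl

G-double : ∀ M c J → G M c (J * 2) ≈ G (M + M) c J ⊛ G (M + M) (M + c) J
G-double M c zero    = ≈-sym (⊛-identityˡ 𝟙)
G-double M c (suc J) = begin
  x ⊛ (y ⊛ G M (M + (M + c)) (J * 2))
    ≈⟨ ⊛-cong ≈-refl (⊛-cong ≈-refl (G-double M (M + (M + c)) J)) ⟩
  x ⊛ (y ⊛ (G N (M + (M + c)) J ⊛ G N (M + (M + (M + c))) J))
    ≈⟨ ⊛-cong ≈-refl (⊛-cong ≈-refl (⊛-cong (G-cong N (sym (+-assoc M M c)) J) (G-cong N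
        (sym (+-assoc M M (M + c))) J))) ⟩
  x ⊛ (y ⊛ (G N (N + c) J ⊛ G N (N + (M + c)) J))
    ≈⟨ solve 4 (λ x y u v → x :* (y :* (u :* v)) := (x :* u) :* (y :* v))
        ≈-refl x y (G N (N + c) J) (G N (N + (M + c)) J) ⟩
  (x ⊛ G N (N + c) J) ⊛ (y ⊛ G N (N + (M + c)) J) ∎
  where
  open ≈-Reasoning
  N = M + M
  x = 𝟙 ⊕ q c
  y = 𝟙 ⊕ q (M + c)

G-triple : ∀ M c J → G M c (J * 3) ≈
           G (M + (M + M)) c J ⊛ G (M + (M + M)) (M + c) J ⊛ G (M + (M + M)) (M + (M + c)) J
G-triple M c zero    = solve 0 (con true := con true :* con true :* con true) ≈-refl
G-triple M c (suc J) = begin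
  x ⊛ (y ⊛ (z ⊛ G M (M + (M + (M + c))) (J * 3)))
    ≈⟨ ⊛-cong ≈-refl (⊛-cong ≈-refl (⊛-cong ≈-refl (≈-trans (G-triple M (M + (M + (M + c))) J)
         (⊛-cong (⊛-cong (shift c) (shift (M + c))) (shift (M + (M + c))))))) ⟩
  x ⊛ (y ⊛ (z ⊛ (G N (N + c) J ⊛ G N (N + (M + c)) J ⊛ G N (N + (M + (M + c))) J)))
    ≈⟨ solve 6 (λ x y z u v w → x :* (y :* (z :* (u :* v :* w))) := (x :* u) :* (y :* v) :* (z :* w)) ≈-refl
         x y z (G N (N + c) J) (G N (N + (M + c)) J) (G N (N + (M + (M + c))) J) ⟩
  (x ⊛ G N (N + c) J) ⊛ (y ⊛ G N (N + (M + c)) J) ⊛ (z ⊛ G N (N + (M + (M + c))) J) ∎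
  where
  open ≈-Reasoning
  N = M + (M + M)
  x = 𝟙 ⊕ q c
  y = 𝟙 ⊕ q (M + c)
  z = 𝟙 ⊕ q (M + (M + c))
  shift : ∀ c → G N (M + (M + (M + c))) J ≈ G N (N + c) J
  shift c = G-cong N (lemma M c) J
    where
    lemma : ∀ M c → M + (M + (M + c)) ≡ M + (M + M) + c
    lemma = ℕ-Solver.solve-∀

-- The Frobenius map of characteristic 2, factor by factor: (1 + x)² = 1 + x².
G-square : ∀ M c J → G M c J ⊛ G M c J ≈ G (M + M) (c + c) J
G-square M c zero    = ⊛-identityˡ 𝟙
G-square M c (suc J) = begin
  (𝟙 ⊕ q c) ⊛ x ⊛ ((𝟙 ⊕ q c) ⊛ x)
    ≈⟨ solve 2 (λ y x →
        (con true :+ y) :* x :* ((con true :+ y) :* x) := (con true :+ y :* y) :* (x :* x)) ≈-refl (q c) x ⟩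
  (𝟙 ⊕ q c ⊛ q c) ⊛ (x ⊛ x)
    ≈⟨ ⊛-cong (⊕-congˡ 𝟙 (q-+ c c)) (≈-trans (G-square M (M + c) J) (G-cong (M + M) (lemma M c) J)) ⟩
  (𝟙 ⊕ q (c + c)) ⊛ G (M + M) (M + M + (c + c)) J ∎
  where
  open ≈-Reasoning
  x = G M (M + c) J
  lemma : ∀ M c → M + c + (M + c) ≡ M + M + (c + c)
  lemma = ℕ-Solver.solve-∀

module _ (M c : ℕ) .{{M≢0 : NonZero M}} .{{c≢0 : NonZero c}} where

  private instance
    +-nonZero : ∀ {m n} .{{_ : NonZero m}} → NonZero (m + n)
    +-nonZero {suc m} = _

  G∞-double : G∞ M c ≈ G∞ (M + M) c ⊛ G∞ (M + M) (M + c)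
  G∞-double = ≈[]⇒≈ λ d → let open ≈[]-Reasoning d in begin
    G∞ M c                                          ≈⟨ G≈G∞ M c (m≤m*n d 2) ⟨
    G M c (d * 2)                                   ≈⟨ ≈⇒≈[] (G-double M c d) ⟩
    G (M + M) c d ⊛ G (M + M) (M + c) d             ≈⟨ ⊛-cong[] (G≈G∞ _ _ ≤-refl) (G≈G∞ _ _ ≤-refl) ⟩
    G∞ (M + M) c ⊛ G∞ (M + M) (M + c)               ∎

  G∞-triple : G∞ M c ≈ G∞ (M + (M + M)) c ⊛ G∞ (M + (M + M)) (M + c) ⊛ G∞ (M + (M + M)) (M + (M + c))
  G∞-triple = ≈[]⇒≈ λ d → let open ≈[]-Reasoning d in begin
    G∞ M c         ≈⟨ G≈G∞ M c (m≤m*n d 3) ⟨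
    G M c (d * 3)  ≈⟨ ≈⇒≈[] (G-triple M c d) ⟩
    G (M + (M + M)) c d ⊛ G (M + (M + M)) (M + c) d ⊛ G (M + (M + M)) (M + (M + c)) d
                   ≈⟨ ⊛-cong[] (⊛-cong[] (G≈G∞ _ _ ≤-refl) (G≈G∞ _ _ ≤-refl)) (G≈G∞ _ _ ≤-refl) ⟩
    G∞ (M + (M + M)) c ⊛ G∞ (M + (M + M)) (M + c) ⊛ G∞ (M + (M + M)) (M + (M + c)) ∎

  G∞-square : G∞ M c ⊛ G∞ M c ≈ G∞ (M + M) (c + c)
  G∞-square = ≈[]⇒≈ λ d → let open ≈[]-Reasoning d in begin
    G∞ M c ⊛ G∞ M c        ≈⟨ ⊛-cong[] (G≈G∞ M c {d} ≤-refl) (G≈G∞ M c ≤-refl) ⟨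
    G M c d ⊛ G M c d      ≈⟨ ≈⇒≈[] (G-square M c d) ⟩
    G (M + M) (c + c) d    ≈⟨ G≈G∞ _ _ ≤-refl ⟩
    G∞ (M + M) (c + c)     ∎

-- The products φ_d as theta series

φ : ℕ → Series
φ d = G∞ d d

φ₁≈θ₂₄ : φ 1 ≈ θ 24
φ₁≈θ₂₄ = ≈-trans (G∞-triple 1 1)
  (≈-trans (⊛-cong (⊛-comm (G∞ 3 1) (G∞ 3 2)) ≈-refl) pentagonal)

-- Splitting the odd exponents modulo 4 writes φ₁ as `G∞ 4 1 ⊛ G∞ 4 3 ⊛ φ 2`. The remaining φ₁² = φ₂
-- joins φ₂ to form φ₄, the third factor of `triangular`.
φ₁³≈θ₈ : φ 1 ⊛ φ 1 ⊛ φ 1 ≈ θ 8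
φ₁³≈θ₈ = ⊛-cancelˡ (φ 2) refl (begin
  φ 2 ⊛ (φ 1 ⊛ φ 1 ⊛ φ 1)                 ≈⟨ ⊛-cong ≈-refl (⊛-cong (G∞-square 1 1) ≈-refl) ⟩
  φ 2 ⊛ (φ 2 ⊛ φ 1)                       ≈⟨ ⊛-cong ≈-refl (⊛-cong ≈-refl
    (≈-trans (G∞-double 1 1) (⊛-cong (G∞-double 2 1) ≈-refl))) ⟩
  φ 2 ⊛ (φ 2 ⊛ (G∞ 4 1 ⊛ G∞ 4 3 ⊛ φ 2))   ≈⟨ solve 3 (λ p x y →
    p :* (p :* (x :* y :* p)) := p :* (y :* x :* (p :* p))) ≈-refl (φ 2) (G∞ 4 1) (G∞ 4 3) ⟩
  φ 2 ⊛ (G∞ 4 3 ⊛ G∞ 4 1 ⊛ (φ 2 ⊛ φ 2))   ≈⟨ ⊛-cong ≈-refl (⊛-cong ≈-refl (G∞-square 2 2)) ⟩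
  φ 2 ⊛ (G∞ 4 3 ⊛ G∞ 4 1 ⊛ φ 4)           ≈⟨ ⊛-cong ≈-refl triangular ⟩
  φ 2 ⊛ θ 8                               ∎)
  where open ≈-Reasoning

-- The product for θ₃ lacks the exponents 3 modulo 6. Multiplying by φ₁φ₃ supplies them through φ₃ =
-- `G∞ 6 3 ⊛ φ 6`; the odd exponents, now complete, combine with φ₁² = φ₂ to φ₁, and φ₆² = φ₃⁴.
φ₁θ₃≈φ₃³ : φ 1 ⊛ θ 3 ≈ φ 3 ⊛ φ 3 ⊛ φ 3
φ₁θ₃≈φ₃³ = ⊛-cancelˡ (φ 1 ⊛ φ 3) refl (begin
  φ 1 ⊛ φ 3 ⊛ (φ 1 ⊛ θ 3)
    ≈⟨ solve 3 (λ x y z → x :* y :* (x :* z) := (x :* x) :* y :* z) ≈-refl (φ 1) (φ 3) (θ 3) ⟩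
  (φ 1 ⊛ φ 1) ⊛ φ 3 ⊛ θ 3
    ≈⟨ ⊛-cong (⊛-cong (G∞-square 1 1) (G∞-double 3 3)) (≈-sym octagonal) ⟩
  φ 2 ⊛ (G∞ 6 3 ⊛ φ 6) ⊛ (G∞ 6 5 ⊛ G∞ 6 1 ⊛ φ 6)
    ≈⟨ solve 5 (λ p x y z s → p :* (y :* s) :* (z :* x :* s) := (x :* y :* z) :* p :* (s :* s))
        ≈-refl (φ 2) (G∞ 6 1) (G∞ 6 3) (G∞ 6 5) (φ 6) ⟩
  (G∞ 6 1 ⊛ G∞ 6 3 ⊛ G∞ 6 5) ⊛ φ 2 ⊛ (φ 6 ⊛ φ 6)
    ≈⟨ ⊛-cong (≈-trans (⊛-cong (≈-sym (G∞-triple 2 1)) ≈-refl) (≈-sym (G∞-double 1 1))) (⊛-cong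
        (≈-sym (G∞-square 3 3)) (≈-sym (G∞-square 3 3))) ⟩
  φ 1 ⊛ (φ 3 ⊛ φ 3 ⊛ (φ 3 ⊛ φ 3))
    ≈⟨ solve 2 (λ x y → x :* (y :* y :* (y :* y)) := x :* y :* (y :* y :* y)) ≈-refl (φ 1) (φ 3) ⟩
  φ 1 ⊛ φ 3 ⊛ (φ 3 ⊛ φ 3 ⊛ φ 3) ∎)
  where open ≈-Reasoning

-- Dilations

q-shift-below : ∀ {m n} f → n < m → (q m ⊛ f) n ≡ false
q-shift-below {m} {n} f n<m =
  trans (at≤ (⊛-cong[] (q-high n<m) ≈[].refl) n ≤-refl) (⊛-zeroˡ-at f n)

data DivView (d : ℕ) : ℕ → Set where
  multiple     : ∀ k → DivView d (k * d)
  non-multiple : ∀ {m} → d ∤ m → DivView d m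

divView : ∀ d m → DivView d m
divView d m with d ∣? m
... | yes (divides k refl) = multiple k
... | no  d∤m              = non-multiple d∤m

module _ (d : ℕ) .{{d≢0 : NonZero d}} where

  opaque
    dil : Series → Series
    dil f m with d ∣? m
    ... | yes d∣m = f (quotient d∣m)
    ... | no  _   = false

    dil-∣ : ∀ f k → dil f (k * d) ≡ f k
    dil-∣ f k with d ∣? k * d
    ... | yes (divides j eq) = cong f (*-cancelʳ-≡ j k d (sym eq))
    ... | no  d∤             = contradiction (n∣m*n k) d∤

    dil-∤ : ∀ f {m} → d ∤ m → dil f m ≡ false
    dil-∤ f {m} d∤m with d ∣? m
    ... | yes d∣m = contradiction d∣m d∤m
    ... | no  _   = refl

  dil-cong[] : ∀ {m f g} → f ≈[ m ] g → dil f ≈[ m ] dil g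
  dil-cong[] {m} {f} {g} p = mk≈[] λ n n≤m → case divView d n of λ where
      (multiple k)       → trans (dil-∣ f k) (trans (at≤ p k (≤-trans (m≤m*n k d) n≤m)) (sym (dil-∣ g k)))
      (non-multiple d∤n) → trans (dil-∤ f d∤n) (sym (dil-∤ g d∤n))

  dil-cong : ∀ {f g} → f ≈ g → dil f ≈ dil g
  dil-cong p = ≈[]⇒≈ λ _ → dil-cong[] (≈⇒≈[] p)

  dil-⊕ : ∀ f g → dil (f ⊕ g) ≈ dil f ⊕ dil g
  dil-⊕ f g = mk≈ λ n → case divView d n of λ where
      (multiple k)       → trans (dil-∣ (f ⊕ g) k) (cong₂ _xor_ (sym (dil-∣ f k)) (sym (dil-∣ g k)))
      (non-multiple d∤n) → trans (dil-∤ (f ⊕ g) d∤n) (cong₂ _xor_ (sym (dil-∤ f d∤n)) (sym (dil-∤ g d∤n)))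

  dil-q : ∀ m → dil (q m) ≈ q (m * d)
  dil-q m = mk≈ λ n → case divView d n of λ where
      (multiple k)       → trans (dil-∣ (q m) k) (case m ≟ k of λ where
        (yes refl) → trans (q-diag m) (sym (q-diag (m * d)))
        (no  m≢k)  → trans (q-off m≢k) (sym (q-off {m * d} (m≢k ∘ *-cancelʳ-≡ m k d))))
      (non-multiple d∤n) → trans (dil-∤ (q m) d∤n) (sym (q-off {m * d} λ { refl → d∤n (n∣m*n m) }))

  dil-tail : ∀ f → dil f ≈ f 0 · 𝟙 ⊕ q d ⊛ dil (tail f)
  dil-tail f = mk≈ λ n → case divView d n of λ where
      (multiple zero)    → trans (dil-∣ f 0) (sym (trans (cong ((f 0 ∧ true) xor_)
                             (q-shift-below (dil (tail f)) (>-nonZero⁻¹ d)))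
                               (trans (xor-identityʳ (f 0 ∧ true)) (∧-identityʳ (f 0)))))
      (multiple (suc k)) → trans (dil-∣ f (suc k)) (sym (trans (positive
        (≤-trans (>-nonZero⁻¹ d) (m≤m+n d (k * d))))
                             (trans (q-shift d (dil (tail f)) (k * d)) (dil-∣ (tail f) k))))
      (non-multiple d∤n) → trans (dil-∤ f d∤n) (sym (trans (positive (n≢0⇒n>0 λ { refl →
        d∤n (d ∣0) })) (off d∤n)))
    where
    positive : ∀ {n} → 0 < n → (f 0 · 𝟙 ⊕ q d ⊛ dil (tail f)) n ≡ (q d ⊛ dil (tail f)) n
    positive {suc n} _ = cong (_xor (q d ⊛ dil (tail f)) (suc n)) (∧-zeroʳ (f 0))

    off : ∀ {n} → d ∤ n → (q d ⊛ dil (tail f)) n ≡ false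
    off {n} d∤n = case n <? d of λ where
        (yes n<d) → q-shift-below (dil (tail f)) n<d
        (no  n≮d) → begin
          (q d ⊛ dil (tail f)) n              ≡⟨ cong (q d ⊛ dil (tail f)) (m+[n∸m]≡n (≮⇒≥ n≮d)) ⟨
          (q d ⊛ dil (tail f)) (d + (n ∸ d))  ≡⟨ q-shift d (dil (tail f)) (n ∸ d) ⟩
          dil (tail f) (n ∸ d)                ≡⟨ dil-∤ (tail f) (λ d∣ → d∤n
            (subst (d ∣_) (m+[n∸m]≡n (≮⇒≥ n≮d)) (∣m∣n⇒∣m+n ∣-refl d∣))) ⟩
          false                               ∎
      where open ≡-Reasoning

  -- A factor in q^d moves exponents only within their residue class modulo d, so extracting the
  -- class of `s` passes through it and replaces q^d by q.
  dil-section : ∀ s → s < d → ∀ g f n → (dil g ⊛ f) (s + n * d) ≡ (g ⊛ (λ i → f (s + i * d))) n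
  dil-section s s<d g f n = trans (at split (s + n * d)) (go n)
    where
    rest = dil (tail g) ⊛ f
    split : dil g ⊛ f ≈ g 0 · f ⊕ q d ⊛ rest
    split = begin
      dil g ⊛ f                              ≈⟨ ⊛-cong (dil-tail g) ≈-refl ⟩
      (g 0 · 𝟙 ⊕ q d ⊛ dil (tail g)) ⊛ f     ≈⟨ ⊛-distribʳ f (g 0 · 𝟙) _ ⟩
      (g 0 · 𝟙) ⊛ f ⊕ q d ⊛ dil (tail g) ⊛ f ≈⟨ ⊕-cong
        (mk≈ λ m → trans (·-⊛-at (g 0) 𝟙 f m) (cong (g 0 ∧_) (⊛-identityˡ-at f m)))
        (solve 3 (λ x y z → x :* y :* z := x :* (y :* z)) ≈-refl (q d) (dil (tail g)) f) ⟩
      g 0 · f ⊕ q d ⊛ rest                   ∎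
      where open ≈-Reasoning
    go : ∀ n → (g 0 · f ⊕ q d ⊛ rest) (s + n * d) ≡ (g ⊛ (λ i → f (s + i * d))) n
    go zero    = trans (cong ((g 0 ∧ f (s + 0)) xor_) (q-shift-below rest (subst (_< d)
      (sym (+-identityʳ s)) s<d)))
                   (xor-identityʳ _)
    go (suc n) = cong ((g 0 ∧ f (s + suc n * d)) xor_) (begin
      (q d ⊛ rest) (s + (d + n * d))         ≡⟨ cong (q d ⊛ rest) (lemma s d (n * d)) ⟩
      (q d ⊛ rest) (d + (s + n * d))         ≡⟨ q-shift d rest (s + n * d) ⟩
      rest (s + n * d)                       ≡⟨ dil-section s s<d (tail g) f n ⟩
      (tail g ⊛ (λ i → f (s + i * d))) n     ∎)
      where
      open ≡-Reasoning
      lemma : ∀ x y z → x + (y + z) ≡ y + (x + z)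
      lemma = ℕ-Solver.solve-∀

  dil-⊛ : ∀ g f → dil (g ⊛ f) ≈ dil g ⊛ dil f
  dil-⊛ g f = mk≈ λ n → case divView d n of λ where
      (multiple k)       → begin
        dil (g ⊛ f) (k * d)              ≡⟨ dil-∣ (g ⊛ f) k ⟩
        (g ⊛ f) k                        ≡⟨ at (⊛-cong ≈-refl (mk≈ (dil-∣ f))) k ⟨
        (g ⊛ (λ i → dil f (i * d))) k    ≡⟨ dil-section 0 (>-nonZero⁻¹ d) g (dil f) k ⟨
        (dil g ⊛ dil f) (k * d)          ∎
      -- The section at the nonzero residue `n % d` meets `dil f` only at zero coefficients.
      (non-multiple {n} d∤n) → begin
        dil (g ⊛ f) n                                ≡⟨ dil-∤ (g ⊛ f) d∤n ⟩
        false                                        ≡⟨ at (⊛-zeroʳ g (mk≈ {λ i →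
          dil f (n % d + i * d)} λ i → dil-∤ f (shift d∤n i))) (n / d) ⟨
        (g ⊛ (λ i → dil f (n % d + i * d))) (n / d)  ≡⟨ dil-section (n % d) (m%n<n n d) g (dil f) (n / d) ⟨
        (dil g ⊛ dil f) (n % d + n / d * d)          ≡⟨ cong (dil g ⊛ dil f) (m≡m%n+[m/n]*n n d) ⟨
        (dil g ⊛ dil f) n                            ∎
    where
    open ≡-Reasoning
    shift : ∀ {n} → d ∤ n → ∀ i → d ∤ n % d + i * d
    shift {n} d∤n i d∣ = d∤n (subst (d ∣_) (sym (m≡m%n+[m/n]*n n d))
      (∣m∣n⇒∣m+n (∣m+n∣m⇒∣n (subst (d ∣_) (+-comm (n % d) (i * d)) d∣) (n∣m*n i)) (n∣m*n (n / d))))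

  dil-G : ∀ M c J → dil (G M c J) ≈ G (M * d) (c * d) J
  dil-G M c zero    = ≈-trans (dil-cong (≈-sym q-zero)) (≈-trans (dil-q 0) q-zero)
  dil-G M c (suc J) = begin
    dil ((𝟙 ⊕ q c) ⊛ G M (M + c) J)            ≈⟨ dil-⊛ (𝟙 ⊕ q c) (G M (M + c) J) ⟩
    dil (𝟙 ⊕ q c) ⊛ dil (G M (M + c) J)        ≈⟨ ⊛-cong (dil-⊕ 𝟙 (q c)) (dil-G M (M + c) J) ⟩
    (dil 𝟙 ⊕ dil (q c)) ⊛ G (M * d) ((M + c) * d) J
      ≈⟨ ⊛-cong (⊕-cong (dil-G M c zero) (dil-q c)) (G-cong (M * d) (*-distribʳ-+ d M c) J) ⟩
    G (M * d) (c * d) (suc J)                  ∎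
    where open ≈-Reasoning

  dil-G∞ : ∀ M c .{{_ : NonZero M}} .{{_ : NonZero c}} → dil (G∞ M c) ≈ G∞ (M * d) (c * d)
  dil-G∞ M c = mk≈ λ n → trans
    (at≤ (dil-cong[] {n} (≈[].sym (G≈G∞ M c ≤-refl))) n ≤-refl) (at (dil-G M c n) n)

-- Dissections of the theta series

∣-square : ∀ {p x} → Prime p → p ∣ x * x → p ∣ x
∣-square {x = x} pr p∣x² = [ id , id ]′ (euclidsLemma x x pr p∣x²)

∣⇒square-∣ : ∀ {p x} → p ∣ x → p * p ∣ x * x
∣⇒square-∣ = λ p∣x → *-pres-∣ p∣x p∣x

square-factor : ∀ {p} .{{_ : NonZero p}} → Prime p → ∀ {m n} → m ≡ p * p * n → sq m ≡ sq n
square-factor {p} pr {n = n} refl = sq-cong shrink grow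
  where
  lemma : ∀ p x → p * p * (x * x) ≡ x * p * (x * p)
  lemma = ℕ-Solver.solve-∀
  grow : Square n → Square (p * p * n)
  grow (x , refl) = x * p , sym (lemma p x)
  shrink : Square (p * p * n) → Square n
  shrink (x , eq) with ∣-square {x = x} pr (subst (p ∣_) (sym (trans eq (*-assoc p p n))) (m∣m*n (p * n)))
  ... | divides y refl = y , *-cancelˡ-≡ (y * y) n (p * p) {{m*n≢0 p p}} (trans (lemma p y) eq)

square-residue : ∀ d .{{_ : NonZero d}} x {r k} → x * x ≡ r + k * d → (x % d) * (x % d) % d ≡ r % d
square-residue d x {r} {k} eq =
  trans (sym (%-distribˡ-* x x d)) (trans (cong (_% d) eq) ([m+kn]%n≡m%n r k d))

prime-3 : Prime 3
prime-3 = from-yes (prime? 3)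

prime-17 : Prime 17
prime-17 = from-yes (prime? 17)

-- An odd square is 1 modulo 8, so 6n + 1 can be a square only if 4 ∣ n; for n = 4k it equals 24k +
-- 1.
θ₃-even : ∀ n → θ 3 (n * 2) ≡ dil 4 (θ 24) n
θ₃-even n = case divView 4 n of λ where
    (multiple k)       → trans (cong sq (lemma k)) (sym (dil-∣ 4 (θ 24) k))
    (non-multiple 4∤n) → trans (sq-false (4∤n ∘ m%n≡0⇒n∣m n 4 ∘ residue)) (sym (dil-∤ 4 (θ 24) 4∤n))
  where
  lemma : ∀ k → 3 * (k * 4 * 2) + 1 ≡ 24 * k + 1
  lemma = ℕ-Solver.solve-∀
  check : ∀ {x} → x < 8 → ∀ {r} → r < 4 → x * x % 8 ≡ (6 * r + 1) % 8 → r ≡ 0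
  check = from-yes (allUpTo? (λ x → allUpTo? (λ r → (x * x % 8 ≟ (6 * r + 1) % 8) →-dec (r ≟ 0)) 4) 8)
  split : ∀ r k → 3 * ((r + k * 4) * 2) + 1 ≡ 6 * r + 1 + 3 * k * 8
  split = ℕ-Solver.solve-∀
  residue : Square (3 * (n * 2) + 1) → n % 4 ≡ 0
  residue (x , eq) = check (m%n<n x 8) (m%n<n n 4) (square-residue 8 x {k = 3 * (n / 4)} (begin
    x * x                                  ≡⟨ eq ⟩
    3 * (n * 2) + 1                        ≡⟨ cong (λ m → 3 * (m * 2) + 1) (m≡m%n+[m/n]*n n 4) ⟩
    3 * ((n % 4 + n / 4 * 4) * 2) + 1      ≡⟨ split (n % 4) (n / 4) ⟩
    6 * (n % 4) + 1 + 3 * (n / 4) * 8      ∎))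
    where open ≡-Reasoning

∤-+-multiple : ∀ d k r → d ∤ r → d ∤ r + k * d
∤-+-multiple d k r d∤r d∣ = d∤r (∣m+n∣m⇒∣n (subst (d ∣_) (+-comm r (k * d)) d∣) (n∣m*n k))

-- By the residue of n modulo 3. For n = 3k, 8n + 1 = 24k + 1. For n ≡ 1, 8n + 1 is divisible by 3,
-- so a square among these is divisible by 9 and n = 1 + 9j gives 9(8j + 1). For n ≡ 2, 8n + 1 is 2
-- modulo 3 and never a square.
θ₈-dissection : θ 8 ≈ dil 3 (θ 24) ⊕ q 1 ⊛ dil 9 (θ 8)
θ₈-dissection = mk≈ λ n → subst (λ m → θ 8 m ≡ (dil 3 (θ 24) ⊕ q 1 ⊛ dil 9 (θ 8)) m)
  (sym (m≡m%n+[m/n]*n n 3)) (go (n % 3) (n / 3) (m%n<n n 3))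
  where
  open ≡-Reasoning
  9∣⇒3∣ : ∀ {m} → 9 ∣ m → 3 ∣ m
  9∣⇒3∣ = ∣-trans (divides 3 refl)

  shifted : ∀ k → (q 1 ⊛ dil 9 (θ 8)) (k * 3) ≡ false
  shifted zero    = refl
  shifted (suc k) = trans (q-shift 1 (dil 9 (θ 8)) (2 + k * 3))
    (dil-∤ 9 (θ 8) (∤-+-multiple 3 k 2 (from-yes (¬? (3 ∣? 2))) ∘ 9∣⇒3∣))

  go : ∀ r k → r < 3 → θ 8 (r + k * 3) ≡ (dil 3 (θ 24) ⊕ q 1 ⊛ dil 9 (θ 8)) (r + k * 3)
  go 0 k _ = begin
    sq (8 * (k * 3) + 1)            ≡⟨ cong sq (lemma k) ⟩
    θ 24 k                          ≡⟨ xor-identityʳ (θ 24 k) ⟨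
    θ 24 k xor false                ≡⟨ cong₂ _xor_ (dil-∣ 3 (θ 24) k) (shifted k) ⟨
    (dil 3 (θ 24) ⊕ q 1 ⊛ dil 9 (θ 8)) (k * 3) ∎
    where
    lemma : ∀ k → 8 * (k * 3) + 1 ≡ 24 * k + 1
    lemma = ℕ-Solver.solve-∀
  go 1 k _ = trans (ninth (divView 9 (k * 3)) refl) (sym (cong₂ _xor_
      (dil-∤ 3 (θ 24) (∤-+-multiple 3 k 1 (from-yes (¬? (3 ∣? 1))))) (q-shift 1 (dil 9 (θ 8)) (k * 3))))
    where
    lemma₁ : ∀ j → 8 * (1 + j * 9) + 1 ≡ 3 * 3 * (8 * j + 1)
    lemma₁ = ℕ-Solver.solve-∀
    lemma₂ : ∀ k → 8 * (1 + k) + 1 ≡ 9 + 8 * k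
    lemma₂ = ℕ-Solver.solve-∀
    lemma₃ : ∀ k → 8 * (1 + k * 3) + 1 ≡ 3 * (3 + 8 * k)
    lemma₃ = ℕ-Solver.solve-∀
    ninth : ∀ {m} → DivView 9 m → m ≡ k * 3 → sq (8 * (1 + m) + 1) ≡ dil 9 (θ 8) m
    ninth (multiple j) _ = trans (square-factor prime-3 (lemma₁ j)) (sym (dil-∣ 9 (θ 8) j))
    ninth (non-multiple {m} 9∤m) refl = trans (sq-false λ (x , eq) →
      9∤m (coprime-divisor {9} {8} (from-yes (coprime? 9 8))
      (∣m+n∣m⇒∣n (subst (9 ∣_) (trans eq (lemma₂ m)) (∣⇒square-∣ {3} {x} (∣-square prime-3
        (subst (3 ∣_) (sym (trans eq (lemma₃ k))) (m∣m*n (3 + 8 * k))))))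
        (∣-refl {9})))) (sym (dil-∤ 9 (θ 8) 9∤m))
  go 2 k _ = trans (sq-false λ (x , eq) → check (m%n<n x 3) (square-residue 3 x {17} {8 * k}
    (trans eq (lemma k))))
    (sym (cong₂ _xor_ (dil-∤ 3 (θ 24) (∤-+-multiple 3 k 2 (from-yes (¬? (3 ∣? 2)))))
      (trans (q-shift 1 (dil 9 (θ 8)) (1 + k * 3)) (dil-∤ 9 (θ 8) (∤-+-multiple 3 k 1
        (from-yes (¬? (3 ∣? 1))) ∘ 9∣⇒3∣)))))
    where
    check : ∀ {x} → x < 3 → x * x % 3 ≢ 2
    check = from-yes (allUpTo? (λ x → ¬? (x * x % 3 ≟ 2)) 3)
    lemma : ∀ k → 8 * (2 + k * 3) + 1 ≡ 17 + 8 * k * 3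
    lemma = ℕ-Solver.solve-∀
  go (suc (suc (suc r))) k (s≤s (s≤s (s≤s ())))

-- 1 + ∑_{n ≥ 1, 3 ∤ n} q^{n²}
Θ : Series
Θ = 𝟙 ⊕ q 1 ⊛ dil 3 (θ 3)

Θ-suc : ∀ m → Θ (suc m) ≡ dil 3 (θ 3) m
Θ-suc m = q-shift 1 (dil 3 (θ 3)) m

Θ-square : ∀ n → Θ n ≡ true → Square n
Θ-square zero    _  = 0 , refl
Θ-square (suc m) eq = case divView 3 m of λ where
    (multiple k)       → subst Square (lemma k) (sq-true⁻ (trans (sym
      (trans (Θ-suc (k * 3)) (dil-∣ 3 (θ 3) k))) eq))
    (non-multiple 3∤m) → contradiction (trans (sym eq) (trans (Θ-suc m) (dil-∤ 3 (θ 3) 3∤m))) λ ()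
  where
  lemma : ∀ k → 3 * k + 1 ≡ 1 + k * 3
  lemma = ℕ-Solver.solve-∀

-- Multiplying y by 17 preserves 3 ∤ y. On exponents, 289 = 1 + 3·96 sends 1 + 3k to 1 + 3(96 +
-- 289k), so the form 1 + 3k is kept while the square is multiplied by 17².
Θ-289 : ∀ n {m} → m ≡ n * 289 → Θ m ≡ Θ n
Θ-289 zero    {zero}  _  = refl
Θ-289 (suc n) {suc m} eq = trans (Θ-suc m) (trans (go (divView 3 n) (suc-injective
  (trans eq (lemma₀ n)))) (sym (Θ-suc n)))
  where
  lemma₀ : ∀ n → (1 + n) * 289 ≡ 1 + (288 + n * 289)
  lemma₀ = ℕ-Solver.solve-∀
  lemma₁ : ∀ k → 288 + k * 3 * 289 ≡ (96 + k * 289) * 3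
  lemma₁ = ℕ-Solver.solve-∀
  lemma₂ : ∀ k → 3 * (96 + k * 289) + 1 ≡ 17 * 17 * (3 * k + 1)
  lemma₂ = ℕ-Solver.solve-∀

  at-multiple : ∀ k {e} → e ≡ 96 + k * 289 → dil 3 (θ 3) (e * 3) ≡ dil 3 (θ 3) (k * 3)
  at-multiple k {e} e≡ = begin
    dil 3 (θ 3) (e * 3)   ≡⟨ dil-∣ 3 (θ 3) e ⟩
    sq (3 * e + 1)        ≡⟨ square-factor prime-17 (trans (cong (λ e → 3 * e + 1) e≡) (lemma₂ k)) ⟩
    sq (3 * k + 1)        ≡⟨ dil-∣ 3 (θ 3) k ⟨
    dil 3 (θ 3) (k * 3)   ∎
    where open ≡-Reasoning

  go : ∀ {n m} → DivView 3 n → m ≡ 288 + n * 289 → dil 3 (θ 3) m ≡ dil 3 (θ 3) n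
  go (multiple k)           m≡ = trans (cong (dil 3 (θ 3)) (trans m≡ (lemma₁ k))) (at-multiple k refl)
  go (non-multiple {n} 3∤n) m≡ = trans
    (dil-∤ 3 (θ 3) λ 3∣m → 3∤n (coprime-divisor {3} {289} (from-yes (coprime? 3 289))
      (subst (3 ∣_) (*-comm n 289) (∣m+n∣m⇒∣n (subst (3 ∣_) m≡ 3∣m) (divides 96 refl)))))
    (sym (dil-∤ 3 (θ 3) 3∤n))

-- Cancelling 17² at the exponents 17n + 12

θ₂₄-289 : ∀ n → θ 24 (12 + n * 289) ≡ θ 24 n
θ₂₄-289 n = square-factor prime-17 (lemma n)
  where
  lemma : ∀ n → 24 * (12 + n * 289) + 1 ≡ 17 * 17 * (24 * n + 1)
  lemma = ℕ-Solver.solve-∀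

-- -24 is not a square modulo 17.
inert : ∀ x y → (x * x + 24 * (y * y)) % 17 ≡ 0 → 17 ∣ x × 17 ∣ y
inert x y eq = let x≡0 , y≡0 = check (m%n<n x 17) (m%n<n y 17) (trans (sym residue) eq)
               in m%n≡0⇒n∣m x 17 x≡0 , m%n≡0⇒n∣m y 17 y≡0
  where
  check : ∀ {a} → a < 17 → ∀ {b} → b < 17 → (a * a + 24 * (b * b)) % 17 ≡ 0 → a ≡ 0 × b ≡ 0
  check = from-yes (allUpTo? (λ a → allUpTo? (λ b →
    ((a * a + 24 * (b * b)) % 17 ≟ 0) →-dec ((a ≟ 0) ×-dec (b ≟ 0))) 17) 17)
  lemma : ∀ a b u v → (a + u * 17) * (a + u * 17) + 24 * ((b + v * 17) * (b + v * 17))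
                    ≡ a * a + 24 * (b * b) + (2 * a * u + u * u * 17 + 24 * (2 * b * v + v * v * 17)) * 17
  lemma = ℕ-Solver.solve-∀
  multiples : ∀ a b u v → ((a + u * 17) * (a + u * 17) + 24 * ((b + v * 17) * (b + v * 17))) % 17
                        ≡ (a * a + 24 * (b * b)) % 17
  multiples a b u v = trans
    (cong (_% 17) (lemma a b u v)) ([m+kn]%n≡m%n (a * a + 24 * (b * b)) (2 * a * u + u * u * 17 + 24 * (2 * b * v + v * v * 17)) 17)
  residue : (x * x + 24 * (y * y)) % 17 ≡ ((x % 17) * (x % 17) + 24 * ((y % 17) * (y % 17))) % 17
  residue = trans (cong₂ (λ x y → (x * x + 24 * (y * y)) % 17) (m≡m%n+[m/n]*n x 17) (m≡m%n+[m/n]*n y 17))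
    (multiples (x % 17) (y % 17) (x / 17) (y / 17))

-- With 24i + 1 = x² and j = y², x² + 24y² = 24(i + j) + 1 = 17(24n + 17), so `inert` makes x and y
-- divisible by 17. Then 17² divides 24i + 1 = 17² + 24(i - 12), and 24 is invertible modulo 17².
support : ∀ n i j → i + j ≡ 12 + n * 17 → θ 24 i ≡ true → Θ j ≡ true →
          (∃ λ i′ → i ≡ 12 + i′ * 289) × 289 ∣ j
support n i j i+j≡ θi Θj with sq-true⁻ θi | Θ-square j Θj
... | x , x²≡ | y , refl = index , ∣⇒square-∣ {17} {y} 17∣y
  where
  lemma₁ : ∀ i j → 24 * i + 1 + 24 * j ≡ 24 * (i + j) + 1
  lemma₁ = ℕ-Solver.solve-∀
  lemma₂ : ∀ n → 24 * (12 + n * 17) + 1 ≡ (17 + 24 * n) * 17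
  lemma₂ = ℕ-Solver.solve-∀
  17∣xy : 17 ∣ x × 17 ∣ y
  17∣xy = inert x y (begin
    (x * x + 24 * (y * y)) % 17          ≡⟨ cong (λ u → (u + 24 * (y * y)) % 17) x²≡ ⟩
    (24 * i + 1 + 24 * (y * y)) % 17     ≡⟨ cong (_% 17) (trans (lemma₁ i (y * y)) (trans (cong (λ u →
      24 * u + 1) i+j≡) (lemma₂ n))) ⟩
    (17 + 24 * n) * 17 % 17              ≡⟨ m*n%n≡0 (17 + 24 * n) 17 ⟩
    0                                    ∎)
    where open ≡-Reasoning
  17∣y = proj₂ 17∣xy
  lemma₃ : ∀ m → 24 * (12 + m) + 1 ≡ 17 * 17 + 24 * m
  lemma₃ = ℕ-Solver.solve-∀
  17²∣ : 17 * 17 ∣ 24 * i + 1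
  17²∣ = subst (17 * 17 ∣_) x²≡ (∣⇒square-∣ {17} {x} (proj₁ 17∣xy))
  -- For `i < 12` the number 24i + 1 lies strictly between 0 and 17²; this makes `i ∸ 12` a true
  -- difference.
  small : ∀ {i} → i < 12 → 17 * 17 ∤ 24 * i + 1
  small = from-yes (allUpTo? (λ i → ¬? (17 * 17 ∣? 24 * i + 1)) 12)
  12≤i : 12 ≤ i
  12≤i = ≮⇒≥ λ i<12 → small i<12 17²∣
  large : ∀ {i} m → 12 + m ≡ i → 17 * 17 ∣ 24 * i + 1 → 17 * 17 ∣ m
  large m refl d∣ = coprime-divisor {17 * 17} {24} (from-yes (coprime? (17 * 17) 24))
    (∣m+n∣m⇒∣n {m = 17 * 17} {n = 24 * m} (subst (17 * 17 ∣_) (lemma₃ m) d∣) (∣-refl {17 * 17}))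
  index : ∃ λ i′ → i ≡ 12 + i′ * 289
  index = let divides i′ eq = large (i ∸ 12) (m+[n∸m]≡n 12≤i) 17²∣
          in i′ , trans (sym (m+[n∸m]≡n 12≤i)) (cong (λ e → 12 + e) eq)

progression? : ∀ s d i → Dec (∃ λ i′ → i ≡ s + i′ * d)
progression? s d i with s ≤? i
... | no  s≰i = no λ { (i′ , refl) → s≰i (m≤m+n s (i′ * d)) }
... | yes s≤i with d ∣? i ∸ s
...   | yes (divides i′ eq) = yes (i′ , trans (sym (m+[n∸m]≡n s≤i)) (cong (λ e → s + e) eq))
...   | no  d∤              = no λ { (i′ , refl) → d∤ (divides i′ (m+n∸m≡n s (i′ * d))) }

module _ (s d : ℕ) .{{d≢0 : NonZero d}} (f : Series) where

  q⊛dil-on : ∀ i → (q s ⊛ dil d f) (s + i * d) ≡ f i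
  q⊛dil-on i = trans (q-shift s (dil d f) (i * d)) (dil-∣ d f i)

  q⊛dil-off : ∀ {i} → ¬ (∃ λ i′ → i ≡ s + i′ * d) → (q s ⊛ dil d f) i ≡ false
  q⊛dil-off {i} none with s ≤? i
  ... | no  s≰i = q-shift-below (dil d f) (≰⇒> s≰i)
  ... | yes s≤i = begin
    (q s ⊛ dil d f) i               ≡⟨ cong (q s ⊛ dil d f) (m+[n∸m]≡n s≤i) ⟨
    (q s ⊛ dil d f) (s + (i ∸ s))   ≡⟨ q-shift s (dil d f) (i ∸ s) ⟩
    dil d f (i ∸ s)                 ≡⟨ dil-∤ d f (λ { (divides i′ eq) → none (i′ , trans
      (sym (m+[n∸m]≡n s≤i)) (cong (λ e → s + e) eq)) }) ⟩
    false                           ∎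
    where open ≡-Reasoning

∧-false : ∀ {x y} → ¬ (x ≡ true × y ≡ true) → x ∧ y ≡ false
∧-false {false}         _ = refl
∧-false {true}  {false} _ = refl
∧-false {true}  {true}  h = contradiction (refl , refl) h

-- At exponents 12 + 17n the convolution agrees term by term with q^{12} θ₂₄(q^{289}) Θ(q^{289}): on
-- the support described by `support` both factors rescale by 17², and elsewhere both terms vanish.
-- Reading a series in q^{289} at 17n amounts to reading it in q^{17} at n.
section₁₇ : ∀ n {m} → m ≡ 12 + n * 17 → (θ 24 ⊛ Θ) m ≡ dil 17 (θ 24 ⊛ Θ) n
section₁₇ n {m} m≡ = begin
  (θ 24 ⊛ Θ) m
    ≡⟨ ⊛-cong-at m (λ i j i+j≡m → term i j (trans i+j≡m m≡)) ⟩
  (q 12 ⊛ dil 289 (θ 24) ⊛ dil 289 Θ) m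
    ≡⟨ at (solve 3 (λ x y z → x :* y :* z := x :* (y :* z)) ≈-refl (q 12) (dil 289 (θ 24)) (dil 289 Θ)) m ⟩
  (q 12 ⊛ (dil 289 (θ 24) ⊛ dil 289 Θ)) m
    ≡⟨ trans
        (cong (q 12 ⊛ (dil 289 (θ 24) ⊛ dil 289 Θ)) m≡) (q-shift 12 (dil 289 (θ 24) ⊛ dil 289 Θ) (n * 17)) ⟩
  (dil 289 (θ 24) ⊛ dil 289 Θ) (n * 17)
    ≡⟨ at (dil-⊛ 289 (θ 24) Θ) (n * 17) ⟨
  dil 289 (θ 24 ⊛ Θ) (n * 17)
    ≡⟨ rescale (divView 17 n) ⟩
  dil 17 (θ 24 ⊛ Θ) n ∎
  where
  open ≡-Reasoning
  rescale : ∀ {n} → DivView 17 n → dil 289 (θ 24 ⊛ Θ) (n * 17) ≡ dil 17 (θ 24 ⊛ Θ) n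
  rescale (multiple k)            = trans (cong (dil 289 (θ 24 ⊛ Θ)) (*-assoc k 17 17))
    (trans (dil-∣ 289 (θ 24 ⊛ Θ) k) (sym (dil-∣ 17 (θ 24 ⊛ Θ) k)))
  rescale (non-multiple {n} 17∤n) =
    trans (dil-∤ 289 (θ 24 ⊛ Θ) (17∤n ∘ *-cancelʳ-∣ {17} {n} 17)) (sym (dil-∤ 17 (θ 24 ⊛ Θ) 17∤n))

  term : ∀ i j → i + j ≡ 12 + n * 17 → θ 24 i ∧ Θ j ≡ (q 12 ⊛ dil 289 (θ 24)) i ∧ dil 289 Θ j
  term i j i+j≡ with progression? 12 289 i | divView 289 j
  ... | yes (i′ , i≡) | multiple k = cong₂ _∧_
    (trans (cong (θ 24) i≡) (trans (θ₂₄-289 i′)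
      (sym (trans (cong (q 12 ⊛ dil 289 (θ 24)) i≡) (q⊛dil-on 12 289 (θ 24) i′)))))
    (trans (Θ-289 k refl) (sym (dil-∣ 289 Θ k)))
  ... | no none | _ = trans
    (∧-false λ (θi , Θj) → none (proj₁ (support n i j i+j≡ θi Θj)))
    (sym (cong (_∧ dil 289 Θ j) (q⊛dil-off 12 289 (θ 24) none)))
  ... | yes _ | non-multiple 289∤j = trans
    (∧-false λ (θi , Θj) → 289∤j (proj₂ (support n i j i+j≡ θi Θj)))
    (sym (trans (cong ((q 12 ⊛ dil 289 (θ 24)) i ∧_) (dil-∤ 289 Θ 289∤j)) (∧-zeroʳ _)))

-- The even part of the generating function

even-part : ∀ {B} → B ⊛ φ 1 ≈ φ 3 → (λ n → B (n * 2)) ≈ θ 24 ⊛ Θ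
-- Multiplied by φ₃, both sides become φ₄ = φ₁⁴.
even-part {B} Bφ₁≈φ₃ = ⊛-cancelˡ (φ 3) refl (≈-trans φ₃A≈φ₄ (≈-sym φ₃θ₂₄Θ≈φ₄))
  where
  open ≈-Reasoning
  A : Series
  A n = B (n * 2)

  φ₆B≈θ₃ : φ 6 ⊛ B ≈ θ 3
  φ₆B≈θ₃ = ⊛-cancelˡ (φ 1) refl (begin
    φ 1 ⊛ (φ 6 ⊛ B)             ≈⟨ ⊛-cong ≈-refl (⊛-cong (≈-sym (G∞-square 3 3)) ≈-refl) ⟩
    φ 1 ⊛ (φ 3 ⊛ φ 3 ⊛ B)       ≈⟨ solve 3 (λ x y b → x :* (y :* y :* b) := y :* y :* (b :* x))
      ≈-refl (φ 1) (φ 3) B ⟩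
    φ 3 ⊛ φ 3 ⊛ (B ⊛ φ 1)       ≈⟨ ⊛-cong ≈-refl Bφ₁≈φ₃ ⟩
    φ 3 ⊛ φ 3 ⊛ φ 3             ≈⟨ φ₁θ₃≈φ₃³ ⟨
    φ 1 ⊛ θ 3                   ∎)

  φ₃A≈φ₄ : φ 3 ⊛ A ≈ φ 4
  φ₃A≈φ₄ = begin
    -- φ₆ is φ₃(q²), so the even coefficients of `φ 6 ⊛ B` involve only the even coefficients of
    -- `B`.
    φ 3 ⊛ A              ≈⟨ mk≈ (dil-section 2 0 (s≤s z≤n) (φ 3) B) ⟨
    (λ n → (dil 2 (φ 3) ⊛ B) (n * 2)) ≈⟨ mk≈ (λ n → at (≈-trans
      (⊛-cong (dil-G∞ 2 3 3) ≈-refl) φ₆B≈θ₃) (n * 2)) ⟩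
    (λ n → θ 3 (n * 2))  ≈⟨ mk≈ θ₃-even ⟩
    dil 4 (θ 24)         ≈⟨ dil-cong 4 φ₁≈θ₂₄ ⟨
    dil 4 (φ 1)          ≈⟨ dil-G∞ 4 1 1 ⟩
    φ 4                  ∎

  cube : ∀ d .{{_ : NonZero d}} M c .{{_ : NonZero M}} .{{_ : NonZero c}} →
         dil d (G∞ M c ⊛ G∞ M c ⊛ G∞ M c) ≈ G∞ (M * d) (c * d) ⊛ G∞ (M * d) (c * d) ⊛ G∞ (M * d) (c * d)
  cube d M c = ≈-trans (dil-⊛ d (G∞ M c ⊛ G∞ M c) (G∞ M c)) (⊛-cong
    (≈-trans (dil-⊛ d (G∞ M c) (G∞ M c)) (⊛-cong (dil-G∞ d M c) (dil-G∞ d M c))) (dil-G∞ d M c))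

  -- The substitution q → q³ in φ₁θ₃ = φ₃³ gives φ₉³, which is φ₁³ = θ₈ at q⁹. This matches the
  -- second term of `θ₈-dissection`.
  φ₃·dil₃θ₃ : φ 3 ⊛ dil 3 (θ 3) ≈ dil 9 (θ 8)
  φ₃·dil₃θ₃ = begin
    φ 3 ⊛ dil 3 (θ 3)             ≈⟨ ⊛-cong (dil-G∞ 3 1 1) ≈-refl ⟨
    dil 3 (φ 1) ⊛ dil 3 (θ 3)     ≈⟨ dil-⊛ 3 (φ 1) (θ 3) ⟨
    dil 3 (φ 1 ⊛ θ 3)             ≈⟨ dil-cong 3 φ₁θ₃≈φ₃³ ⟩
    dil 3 (φ 3 ⊛ φ 3 ⊛ φ 3)       ≈⟨ cube 3 3 3 ⟩
    φ 9 ⊛ φ 9 ⊛ φ 9               ≈⟨ cube 9 1 1 ⟨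
    dil 9 (φ 1 ⊛ φ 1 ⊛ φ 1)       ≈⟨ dil-cong 9 φ₁³≈θ₈ ⟩
    dil 9 (θ 8)                   ∎

  φ₃Θ≈φ₁³ : φ 3 ⊛ Θ ≈ φ 1 ⊛ φ 1 ⊛ φ 1
  φ₃Θ≈φ₁³ = begin
    φ 3 ⊛ (𝟙 ⊕ q 1 ⊛ dil 3 (θ 3))
      ≈⟨ solve 3 (λ x y z → x :* (con true :+ y :* z) := x :+ y :* (x :* z))
          ≈-refl (φ 3) (q 1) (dil 3 (θ 3)) ⟩
    φ 3 ⊕ q 1 ⊛ (φ 3 ⊛ dil 3 (θ 3))
      ≈⟨ ⊕-cong (≈-trans (≈-sym (dil-G∞ 3 1 1)) (dil-cong 3 φ₁≈θ₂₄)) (⊛-cong ≈-refl φ₃·dil₃θ₃) ⟩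
    dil 3 (θ 24) ⊕ q 1 ⊛ dil 9 (θ 8)
      ≈⟨ θ₈-dissection ⟨
    θ 8
      ≈⟨ φ₁³≈θ₈ ⟨
    φ 1 ⊛ φ 1 ⊛ φ 1 ∎

  φ₃θ₂₄Θ≈φ₄ : φ 3 ⊛ (θ 24 ⊛ Θ) ≈ φ 4
  φ₃θ₂₄Θ≈φ₄ = begin
    φ 3 ⊛ (θ 24 ⊛ Θ)                  ≈⟨ solve 3 (λ x y z → x :* (y :* z) := y :* (x :* z))
      ≈-refl (φ 3) (θ 24) Θ ⟩
    θ 24 ⊛ (φ 3 ⊛ Θ)                  ≈⟨ ⊛-cong (≈-sym φ₁≈θ₂₄) φ₃Θ≈φ₁³ ⟩
    φ 1 ⊛ (φ 1 ⊛ φ 1 ⊛ φ 1)           ≈⟨ solve 1 (λ x →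
      x :* (x :* x :* x) := (x :* x) :* (x :* x)) ≈-refl (φ 1) ⟩
    (φ 1 ⊛ φ 1) ⊛ (φ 1 ⊛ φ 1)         ≈⟨ ⊛-cong (G∞-square 1 1) (G∞-square 1 1) ⟩
    φ 2 ⊛ φ 2                         ≈⟨ G∞-square 2 2 ⟩
    φ 4                               ∎

-- The generating function of the regular partitions modulo 2

partitionsUpTo-below : ∀ {k n} → n < suc k → partitionsUpTo (suc k) n ≡ partitionsUpTo k n
partitionsUpTo-below {k} {n} n<1+k rewrite m<n⇒m/n≡0 n<1+k =
  trans (++-identityʳ (map id (partitionsUpTo k n))) (map-id (partitionsUpTo k n))

-- Block 0 has no part `suc k`. Removing one copy of that part from the other blocks leaves the
-- blocks for `m`, so the listing by multiplicity obeys the usual recursion on partitions.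
partitionsUpTo-step : ∀ k m → partitionsUpTo (suc k) (suc k + m) ≡
                      partitionsUpTo k (suc k + m) ++ map (suc k ∷_) (partitionsUpTo (suc k) m)
partitionsUpTo-step k m = begin
  concatMap (block n) (upTo (suc (n / suc k)))
    ≡⟨ cong (λ j → concatMap (block n) (upTo (suc j))) quotient≡ ⟩
  map id (partitionsUpTo k n) ++ concatMap (block n) (applyUpTo suc (suc (m / suc k)))
    ≡⟨ cong₂ _++_ (map-id (partitionsUpTo k n)) (cong (concatMap (block n))
        (sym (map-upTo suc (suc (m / suc k))))) ⟩
  partitionsUpTo k n ++ concatMap (block n) (map suc (upTo (suc (m / suc k))))
    ≡⟨ cong (partitionsUpTo k n ++_) (concatMap-map (block n) suc (upTo (suc (m / suc k)))) ⟩
  partitionsUpTo k n ++ concatMap (block n ∘ suc) (upTo (suc (m / suc k)))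
    ≡⟨ cong (partitionsUpTo k n ++_) (concatMap-cong block-suc (upTo (suc (m / suc k)))) ⟩
  partitionsUpTo k n ++ concatMap (map (suc k ∷_) ∘ block m) (upTo (suc (m / suc k)))
    ≡⟨ cong (partitionsUpTo k n ++_) (map-concatMap (suc k ∷_) (block m) (upTo (suc (m / suc k)))) ⟨
  partitionsUpTo k n ++ map (suc k ∷_) (partitionsUpTo (suc k) m) ∎
  where
  open ≡-Reasoning
  n = suc k + m
  block : ℕ → ℕ → List (List ℕ)
  block n j = map (replicate j (suc k) ++_) (partitionsUpTo k (n ∸ j * suc k))
  quotient≡ : n / suc k ≡ suc (m / suc k)
  quotient≡ = trans (m/n≡1+[m∸n]/n (m≤m+n (suc k) m)) (cong (λ i → suc (i / suc k)) (m+n∸m≡n (suc k) m))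
  block-suc : ∀ j → block n (suc j) ≡ map (suc k ∷_) (block m j)
  block-suc j = trans
    (cong (map (replicate (suc j) (suc k) ++_) ∘ partitionsUpTo k) ([m+n]∸[m+o]≡n∸o (suc k) m (j * suc k)))
    (map-∘ (partitionsUpTo k (m ∸ j * suc k)))

parity : ℕ → Bool
parity zero    = false
parity (suc n) = not (parity n)

parity-+ : ∀ m n → parity (m + n) ≡ parity m xor parity n
parity-+ zero    n = refl
parity-+ (suc m) n = trans (cong not (parity-+ m n)) (not-distribˡ-xor (parity m) (parity n))

module _ (ℓ : ℕ) where

  count : List (List ℕ) → ℕ
  count xss = length (filter (isRegular? ℓ) xss)

  count-++ : ∀ xss yss → count (xss ++ yss) ≡ count xss + count yss
  count-++ xss yss = trans
    (cong length (filter-++ (isRegular? ℓ) xss yss)) (length-++ (filter (isRegular? ℓ) xss))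

  count-∣ : ∀ {x} → ℓ ∣ x → ∀ xss → count (map (x ∷_) xss) ≡ 0
  count-∣ ℓ∣x []         = refl
  count-∣ {x} ℓ∣x (xs ∷ xss) = trans
    (cong length (filter-reject (isRegular? ℓ) {x ∷ xs} {map (x ∷_) xss} λ { (ℓ∤x ∷ _) → ℓ∤x ℓ∣x }))
    (count-∣ ℓ∣x xss)

  count-∤ : ∀ {x} → ℓ ∤ x → ∀ xss → count (map (x ∷_) xss) ≡ count xss
  count-∤ ℓ∤x []         = refl
  count-∤ {x} ℓ∤x (xs ∷ xss) = case isRegular? ℓ xs of λ where
      (yes r) → begin
        count (map (x ∷_) (xs ∷ xss))       ≡⟨ cong length (filter-accept (isRegular? ℓ) {x ∷ xs} {map (x ∷_) xss} (ℓ∤x ∷ r)) ⟩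
        suc (count (map (x ∷_) xss))        ≡⟨ cong suc (count-∤ ℓ∤x xss) ⟩
        suc (count xss)                     ≡⟨ cong length (filter-accept (isRegular? ℓ) {xs} {xss} r) ⟨
        count (xs ∷ xss)                    ∎
      (no ¬r) → begin
        count (map (x ∷_) (xs ∷ xss))       ≡⟨ cong length (filter-reject (isRegular? ℓ) {x ∷ xs} {map (x ∷_) xss} (λ { (_ ∷ r) → ¬r r })) ⟩
        count (map (x ∷_) xss)              ≡⟨ count-∤ ℓ∤x xss ⟩
        count xss                           ≡⟨ cong length (filter-reject (isRegular? ℓ) {xs} {xss} ¬r) ⟨
        count (xs ∷ xss)                    ∎
    where open ≡-Reasoning

  -- The generating function modulo 2 of the ℓ-regular partitions with parts at most `k`.
  R : ℕ → Series
  R k n = parity (count (partitionsUpTo k n))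

  R-zero : R 0 ≈ 𝟙
  R-zero = mk≈ λ { zero → refl ; (suc n) → refl }

  R-below : ∀ {k n} → n < suc k → R (suc k) n ≡ R k n
  R-below n<1+k = cong (parity ∘ count) (partitionsUpTo-below n<1+k)

  R-step : ∀ k m → R (suc k) (suc k + m)
    ≡ R k (suc k + m) xor parity (count (map (suc k ∷_) (partitionsUpTo (suc k) m)))
  R-step k m = trans (cong parity (trans (cong count (partitionsUpTo-step k m))
    (count-++ (partitionsUpTo k (suc k + m)) (map (suc k ∷_) (partitionsUpTo (suc k) m)))))
    (parity-+ (count (partitionsUpTo k (suc k + m))) _)

  by-size : ∀ k (P : ℕ → Set) → (∀ {n} → n < k → P n) → (∀ m → P (k + m)) → ∀ n → P n
  by-size k P small large n with n <? k
  ... | yes n<k = small n<k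
  ... | no  n≮k = subst P (m+[n∸m]≡n (≮⇒≥ n≮k)) (large (n ∸ k))

  R-∣ : ∀ k → ℓ ∣ suc k → R (suc k) ≈ R k
  R-∣ k ℓ∣ = mk≈ (by-size (suc k) (λ n → R (suc k) n ≡ R k n) R-below λ m →
    trans (R-step k m) (trans (cong (λ c →
      R k (suc k + m) xor parity c) (count-∣ ℓ∣ (partitionsUpTo (suc k) m))) (xor-identityʳ _)))

  R-∤ : ∀ k → ℓ ∤ suc k → R (suc k) ⊛ (𝟙 ⊕ q (suc k)) ≈ R k
  R-∤ k ℓ∤ = begin
    R (suc k) ⊛ (𝟙 ⊕ q (suc k))          ≈⟨ solve 2 (λ r x →
      r :* (con true :+ x) := r :+ x :* r) ≈-refl (R (suc k)) (q (suc k)) ⟩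
    R (suc k) ⊕ q (suc k) ⊛ R (suc k)    ≈⟨ ⊕-congʳ (q (suc k) ⊛ R (suc k)) recurrence ⟩
    R k ⊕ q (suc k) ⊛ R (suc k) ⊕ q (suc k) ⊛ R (suc k) ≈⟨ solve 2 (λ x y → x :+ y :+ y := x)
      ≈-refl (R k) (q (suc k) ⊛ R (suc k)) ⟩
    R k                                  ∎
    where
    open ≈-Reasoning
    recurrence : R (suc k) ≈ R k ⊕ q (suc k) ⊛ R (suc k)
    recurrence = mk≈ (by-size (suc k) (λ n → R (suc k) n ≡ (R k ⊕ q (suc k) ⊛ R (suc k)) n)
      (λ {n} n<1+k → trans (R-below n<1+k) (sym (trans
        (cong (R k n xor_) (q-shift-below (R (suc k)) n<1+k)) (xor-identityʳ _))))
      λ m → trans (R-step k m) (cong (R k (suc k + m) xor_)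
        (trans (cong parity (count-∤ ℓ∤ (partitionsUpTo (suc k) m)))
          (sym (q-shift (suc k) (R (suc k)) m)))))

  B : Series
  B n = parity (b ℓ n)

  R-stable : ∀ j n → R (j + n) n ≡ B n
  R-stable zero    n = refl
  R-stable (suc j) n = trans (R-below (s≤s (m≤n+m n j))) (R-stable j n)

  R≈B : ∀ {d k} → d ≤ k → R k ≈[ d ] B
  R≈B {d} {k} d≤k = mk≈[] λ n n≤d →
    subst (λ k → R k n ≡ B n) (m∸n+n≡m (≤-trans n≤d d≤k)) (R-stable (k ∸ n) n)

-- Bounding the parts by a multiple of 3 makes the identity exact at each finite stage. The factors
-- for 3J + 1 and 3J + 2 cancel against the allowed parts; the part 3J + 3 is forbidden, so its
-- factor survives and extends the right side.
R-product : ∀ J → R 3 (J * 3) ⊛ G 1 1 (J * 3) ≈ G 3 3 J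
R-product zero    = ≈-trans (⊛-cong (R-zero 3) ≈-refl) (⊛-identityˡ 𝟙)
R-product (suc J) = begin
  R 3 (3 + k) ⊛ G 1 1 (3 + k)
    ≈⟨ ⊛-cong (R-∣ 3 (2 + k) (∣m∣n⇒∣m+n ∣-refl (n∣m*n J))) last₃ ⟩
  R 3 (2 + k) ⊛ (G 1 1 k ⊛ x ⊛ y ⊛ z)
    ≈⟨ solve 5 (λ r g x y z → r :* (g :* x :* y :* z) := (r :* y) :* x :* g :* z)
        ≈-refl (R 3 (2 + k)) (G 1 1 k) x y z ⟩
  (R 3 (2 + k) ⊛ y) ⊛ x ⊛ G 1 1 k ⊛ z
    ≈⟨ ⊛-cong (⊛-cong (≈-trans (⊛-cong (R-∤ 3 (1 + k) (∤-+-multiple 3 J 2 (from-yes (¬? (3 ∣? 2))))) ≈-refl)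
                               (R-∤ 3 k (∤-+-multiple 3 J 1 (from-yes (¬? (3 ∣? 1)))))) ≈-refl) ≈-refl ⟩
  R 3 k ⊛ G 1 1 k ⊛ z
    ≈⟨ ⊛-cong (R-product J) (⊕-congˡ 𝟙 (q-cong (+-comm 3 k))) ⟩
  G 3 3 J ⊛ (𝟙 ⊕ q (k + 3))
    ≈⟨ G-last 3 3 J ⟨
  G 3 3 (suc J) ∎
  where
  open ≈-Reasoning
  k = J * 3
  x = 𝟙 ⊕ q (1 + k)
  y = 𝟙 ⊕ q (2 + k)
  z = 𝟙 ⊕ q (3 + k)
  last : ∀ k → G 1 1 (suc k) ≈ G 1 1 k ⊛ (𝟙 ⊕ q (suc k))
  last k = ≈-trans (G-last 1 1 k) (⊛-cong ≈-refl (⊕-congˡ 𝟙 (q-cong (trans (+-comm (k * 1) 1)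
    (cong suc (*-identityʳ k))))))
  last₃ : G 1 1 (3 + k) ≈ G 1 1 k ⊛ x ⊛ y ⊛ z
  last₃ = ≈-trans (last (2 + k)) (⊛-cong (≈-trans (last (1 + k)) (⊛-cong (last k) ≈-refl)) ≈-refl)

Bφ₁≈φ₃ : B 3 ⊛ φ 1 ≈ φ 3
Bφ₁≈φ₃ = ≈[]⇒≈ λ d → let open ≈[]-Reasoning d in begin
  B 3 ⊛ φ 1                        ≈⟨ ⊛-cong[] (R≈B 3 (m≤m*n d 3)) (G≈G∞ 1 1 (m≤m*n d 3)) ⟨
  R 3 (d * 3) ⊛ G 1 1 (d * 3)      ≈⟨ ≈⇒≈[] (R-product d) ⟩
  G 3 3 d                          ≈⟨ G≈G∞ 3 3 ≤-refl ⟩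
  φ 3                              ∎

-- The congruences

parity-even : ∀ n → parity n ≡ false → 2 ∣ n
parity-even zero          _  = 2 ∣0
parity-even (suc (suc n)) eq = ∣m∣n⇒∣m+n ∣-refl (parity-even n (trans (sym (not-involutive (parity n))) eq))

parity-⊖ : ∀ m n → parity m ≡ parity n → 2 ∣ ℤ.∣ m ⊖ n ∣
parity-⊖ zero    zero    _  = 2 ∣0
parity-⊖ zero    (suc n) eq = parity-even (suc n) (sym eq)
parity-⊖ (suc m) zero    eq = parity-even (suc m) eq
parity-⊖ (suc m) (suc n) eq = subst (λ z → 2 ∣ ℤ.∣ z ∣)
  (sym ([1+m]⊖[1+n]≡m⊖n m n)) (parity-⊖ m n (not-injective eq))

parity-≡ : ∀ m n → parity m ≡ parity n → + m ≡ + n [mod + 2 ]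
parity-≡ m n eq = subst (λ z → 2 ∣ ℤ.∣ z ∣) (sym (m-n≡m⊖n m n)) (parity-⊖ m n eq)

B-section : ∀ n {m} → m ≡ 34 * n + 24 → B 3 m ≡ dil 17 (λ k → B 3 (k * 2)) n
B-section n {m} m≡ = begin
  B 3 m                           ≡⟨ cong (B 3) (trans m≡ (lemma n)) ⟩
  B 3 ((12 + n * 17) * 2)         ≡⟨ at (even-part Bφ₁≈φ₃) (12 + n * 17) ⟩
  (θ 24 ⊛ Θ) (12 + n * 17)        ≡⟨ section₁₇ n refl ⟩
  dil 17 (θ 24 ⊛ Θ) n             ≡⟨ at (dil-cong 17 (even-part Bφ₁≈φ₃)) n ⟨
  dil 17 (λ k → B 3 (k * 2)) n    ∎
  where
  open ≡-Reasoning
  lemma : ∀ n → 34 * n + 24 ≡ (12 + n * 17) * 2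
  lemma = ℕ-Solver.solve-∀

B-multiple : ∀ k {m n} → m ≡ 34 * (k * 17) + 24 → n ≡ 2 * k → B 3 m ≡ B 3 n
B-multiple k m≡ n≡ = trans (B-section (k * 17) m≡)
  (trans (dil-∣ 17 (λ k → B 3 (k * 2)) k) (cong (B 3) (sym (trans n≡ (*-comm 2 k)))))

B-non-multiple : ∀ n {m} → m ≡ 34 * n + 24 → 17 ∤ n → B 3 m ≡ false
B-non-multiple n m≡ 17∤n = trans (B-section n m≡) (dil-∤ 17 (λ k → B 3 (k * 2)) 17∤n)

congruence : (λ n → + b 3 (34 * n + 24)) ≋ dilate 17 (λ n → + b 3 (2 * n)) [mod + 2 ]
congruence n with 17 ∣? n
... | yes (divides k n≡) = parity-≡ (b 3 (34 * n + 24)) (b 3 (2 * k))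
        (B-multiple k (cong (λ n → 34 * n + 24) n≡) refl)
... | no  17∤n           = parity-≡ (b 3 (34 * n + 24)) 0 (B-non-multiple n refl 17∤n)

-- (289ᵏ - 1) / 288
repunit : ℕ → ℕ
repunit zero    = 0
repunit (suc k) = 1 + 289 * repunit k

289^k≡ : ∀ k → 289 ^ k ≡ 1 + repunit k * 288
289^k≡ zero    = refl
289^k≡ (suc k) = trans (cong (289 *_) (289^k≡ k)) (lemma (repunit k))
  where
  lemma : ∀ w → 289 * (1 + w * 288) ≡ 1 + (1 + 289 * w) * 288
  lemma = ℕ-Solver.solve-∀

-- At `k = 0` the index is 34(17n + 1) + 24, and 17n + 1 is prime to 17. For `suc k` it is 34·17j +
-- 24, where 2j is the index for `k`: the recursion 1 + 289w of `repunit` absorbs the summand 24.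
B-tower : ∀ k n {m} → m ≡ 2 * (289 * 289 ^ k) * n + 289 ^ k * 58 + 24 * repunit k → B 3 m ≡ false
B-tower zero    n m≡ = B-non-multiple (1 + n * 17) (trans m≡ (lemma n)) (∤-+-multiple 17 n 1
  (from-yes (¬? (17 ∣? 1))))
  where
  lemma : ∀ n → 2 * (289 * 1) * n + 1 * 58 + 24 * 0 ≡ 34 * (1 + n * 17) + 24
  lemma = ℕ-Solver.solve-∀
B-tower (suc k) n {m} m≡ = trans
  (B-multiple (289 * 289 ^ k * n + 289 ^ k * 29 + 12 * repunit k)
    (trans m≡ (lemma₁ (289 ^ k) (repunit k) n))
    (lemma₂ (289 ^ k) (repunit k) n))
  (B-tower k n refl)
  where
  lemma₁ : ∀ e w n → 2 * (289 * (289 * e)) * n + 289 * e * 58 + 24 * (1 + 289 * w)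
                   ≡ 34 * ((289 * e * n + e * 29 + 12 * w) * 17) + 24
  lemma₁ = ℕ-Solver.solve-∀
  lemma₂ : ∀ e w n → 2 * (289 * e) * n + e * 58 + 24 * w ≡ 2 * (289 * e * n + e * 29 + 12 * w)
  lemma₂ = ℕ-Solver.solve-∀

index : ℕ → ℕ → ℕ
index k n = 2 * 17 ^ (2 * suc k) * n + 17 ^ (2 * suc k ∸ 2) * 58 + 24 * ((17 ^ (2 * suc k ∸ 2) ∸ 1) / 288)

index≡ : ∀ k n → index k n ≡ 2 * (289 * 289 ^ k) * n + 289 ^ k * 58 + 24 * repunit k
index≡ k n = cong₂ _+_
  (cong₂ (λ x y → 2 * x * n + y * 58) (sym (^-*-assoc 17 2 (suc k))) power)
  (cong (24 *_) (trans (cong (λ x → (x ∸ 1) / 288) (trans power (289^k≡ k))) (m*n/n≡m (repunit k) 288)))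
  where
  power : 17 ^ (2 * suc k ∸ 2) ≡ 289 ^ k
  power = trans (cong (17 ^_) (sym (*-distribˡ-∸ 2 (suc k) 1))) (sym (^-*-assoc 17 2 k))

theorem1p2 : ((λ n → + b 3 (34 * n + 24)) ≋ dilate 17 (λ n → + b 3 (2 * n)) [mod + 2 ])
    × (∀ (n : ℕ) → + b 3 (2 * 17 ^ 2 * n + 58) ≡ + 0 [mod + 2 ])
    × (∀ (k n : ℕ) → k ≥ 1 →
    + b 3 (2 * 17 ^ (2 * k) * n + 17 ^ (2 * k ∸ 2) * 58
    + 24 * ((17 ^ (2 * k ∸ 2) ∸ 1) / 288)) ≡ + 0 [mod + 2 ])
theorem1p2 =
    congruence
  , (λ n → parity-≡ (b 3 (2 * 17 ^ 2 * n + 58)) 0 (B-tower 0 n (lemma n)))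
  , λ { (suc k) n _ → parity-≡ (b 3 (index k n)) 0 (B-tower k n (index≡ k n)) }
  where
  lemma : ∀ n → 578 * n + 58 ≡ 2 * (289 * 1) * n + 1 * 58 + 24 * 0
  lemma = ℕ-Solver.solve-∀
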